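{- Let $1<k\le n$ be integers, and let $P=\mathrm{Poset}(\mathrm{PF}_{n,k})$, with minimum $\hat 0$ and maximum $\hat 1$. Then $\mu(P):=\mu_P(\hat 0,\hat 1)=0$.
   Context: The Möbius function $\mu_P:P\times P\to\mathbb{Z}$ of a finite poset $P$ is defined by $\mu_P(x,x)=1$, $\mu_P(x,y)=-\sum_{x\le z<y}\mu_P(x,z)$ if $x<y$, and $\mu_P(x,y)=0$ otherwise. "The Möbius function of $P$", for a bounded poset $P$, means the number $\mu_P(\hat 0,\hat 1)$. Write $[n]=\{1,\dots,n\}$. A parking function of length $n$ is an $n$-tuple $(a_1,\dots,a_n)$ of positive integers whose weakly increasing rearrangement $b_1\le\dots\le b_n$ satisfies $b_i\le i$ for all $i$; $\mathrm{PF}_n$ is the set of these. For $1<k\le n$, $\mathrm{PF}_{n,k}$ is the set of $a\in\mathrm{PF}_n$ such that $k$ is not an entry of $a$ but each of $k+1,\dots,n$ is an entry of $a$. $\mathrm{NC}_m$ is the lattice of noncrossing partitions of $[m]$ (partitions for which, placing $1,\dots,m$ in clockwise order on a circle, the convex hulls of the blocks are pairwise disjoint), ordered by refinement, with the finer partition being smaller. Each covering relation $\sigma<\tau$ in $\mathrm{NC}_{n+1}$ merges two blocks $B_1,B_2$ of $\sigma$ into one block $B=B_1\cup B_2$ of $\tau$; name them so that $\min B\in B_1$, and label the covering relation by the largest element of $B_1$ that is less than every element of $B_2$. Reading the labels of a maximal chain of $\mathrm{NC}_{n+1}$ from bottom to top gives a parking function of length $n$, and this is a (known) bijection from maximal chains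 of $\mathrm{NC}_{n+1}$ to $\mathrm{PF}_n$. $\mathrm{Poset}(\mathrm{PF}_{n,k})$ is the poset whose Hasse diagram is the union of the maximal chains of $\mathrm{NC}_{n+1}$ corresponding to elements of $\mathrm{PF}_{n,k}$: its elements are the noncrossing partitions lying on at least one of these chains, and its order is the reflexive-transitive closure of the covering relations occurring in these chains (it need not be an induced subposet of $\mathrm{NC}_{n+1}$). -}

module Defs where

open import Level using (Level; _⊔_) renaming (suc to lsuc)
open import Data.Bool.Base using (Bool; true; false)
import Data.Bool.Properties as Bool
open import Data.Fin.Base as Fin using (Fin; zero; suc; toℕ; fromℕ; inject₁)
open import Data.Fin.Induction using (spo-wellFounded; spo-noetherian)
import Data.Fin.Properties as Fin
open import Data.Fin.Subset using (Subset; _∈_; _⊆_; _∪_)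
open import Data.Fin.Subset.Properties using (_∈?_; _⊆?_; anySubset?; ⊆-antisym)
open import Data.Integer.Base as ℤ using (ℤ; 0ℤ; 1ℤ)
import Data.Integer.Properties as ℤ
open import Data.Irrelevant using ([_])
open import Data.List.Base as List using (List; []; _∷_)
import Data.List.Membership.Propositional as List
open import Data.List.Membership.Propositional.Properties
  using (∈-cartesianProductWith⁺; ∈-deduplicate⁺; ∈-allFin)
open import Data.List.Properties using (map-cong)
open import Data.List.Relation.Unary.Any as Any using (here; there)
open import Data.List.Relation.Unary.Any.Properties using (lookup-index)
open import Data.List.Relation.Unary.Unique.Propositional using (Unique)
open import Data.List.Relation.Unary.Unique.DecPropositional.Properties using (deduplicate-!)
open import Data.Nat.Base as ℕ using (ℕ; zero; suc; s≤s)
import Data.Nat.Properties as ℕ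
open import Data.List.Sort ℕ.≤-decTotalOrder using (sort)
open import Data.Product.Base using (∃; ∃₂; _×_; _,_; proj₁; proj₂)
open import Data.Refinement using (Refinement; Refinement-syntax; _,_; value)
import Data.Refinement.Properties as Refinement
open import Data.Vec.Base as Vec using (Vec; []; _∷_; lookup)
open import Data.Vec.Membership.DecPropositional ℕ._≟_ using ()
  renaming (_∈_ to _∈ᵥ_; _∉_ to _∉ᵥ_; _∈?_ to _∈ᵥ?_)
open import Data.Vec.Properties using (≡-dec; tabulate∘lookup; tabulate-cong)
open import Function.Base using (_∘_; _on_; flip)
open import Induction.WellFounded using (Acc; acc; WellFounded; module Subrelation)
open import Relation.Binary.Core using (Rel)
open import Relation.Binary.Construct.Closure.ReflexiveTransitive 
  using (Star; ε; _◅_; _◅◅_)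
import Relation.Binary.Construct.NonStrictToStrict as Strict
import Relation.Binary.Construct.On as On
open import Relation.Binary.Definitions using (Decidable; DecidableEquality; Minimum; Maximum)
open import Relation.Binary.PropositionalEquality
  using (_≡_; _≢_; refl; sym; trans; cong; cong₂; subst₂; isEquivalence)
open import Relation.Binary.Structures using (IsDecPartialOrder; IsStrictPartialOrder)
open import Relation.Nullary using (¬_; Dec; yes; no; ¬?; _×-dec_; _→-dec_; contradiction-irr)
open import Relation.Nullary.Decidable using (map′; decidable-stable)
open import Relation.Unary as U using (Pred)

private
  variable
    a ℓ p : Level
    A : Set a
    m n : ℕ

record Enumeration (A : Set a) : Set a where
  field
    elements : List A
    complete : ∀ x → x List.∈ elements

  exists? : {P : Pred A p} → U.Decidable P → Dec (∃ P)
  exists? P? = map′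
    (λ any → Any.lookup any , lookup-index any)
    (λ (x , Px) → List.lose (complete x) Px)
    (Any.any? P? elements)

  forall? : {P : Pred A p} → U.Decidable P → Dec (∀ x → P x)
  forall? P? with exists? (¬? ∘ P?)
  ... | yes (x , ¬Px) = no λ all → ¬Px (all x)
  ... | no  ¬∃¬P      = yes λ x → decidable-stable (P? x) (λ ¬Px → ¬∃¬P (x , ¬Px))

fins : Enumeration (Fin n)
fins = record { elements = List.allFin _ ; complete = ∈-allFin }

bools : Enumeration Bool
bools = record
  { elements = false ∷ true ∷ []
  ; complete = λ { false → here refl ; true → there (here refl) }
  }

vecs : Enumeration A → ∀ n → Enumeration (Vec A n)
vecs E zero    = record { elements = [] ∷ [] ; complete = λ { [] → here refl } }
vecs E (suc n) = record
  { elements = List.cartesianProductWith _∷_ E.elements Es.elements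
  ; complete = λ { (x ∷ xs) → ∈-cartesianProductWith⁺ _∷_ (E.complete x) (Es.complete xs) }
  }
  where
  module E  = Enumeration E
  module Es = Enumeration (vecs E n)

refinements : {P : Pred A p} → U.Decidable P → Enumeration A → Enumeration [ x ∈ A ∣ P x ]
refinements {A = A} {P = P} P? E = record
  { elements = select elements
  ; complete = λ { (x , [ Px ]) → select⁺ elements (complete x) Px }
  }
  where
  open Enumeration E

  select : List A → List [ x ∈ A ∣ P x ]
  select []       = []
  select (x ∷ xs) with P? x
  ... | yes Px = (x , [ Px ]) ∷ select xs
  ... | no  _  = select xs

  select⁺ : ∀ xs {x} → x List.∈ xs → .(Px : P x) → (x , [ Px ]) List.∈ select xs
  select⁺ (x ∷ xs) x∈ Px with P? x
  select⁺ (x ∷ xs) (here refl) Px | yes _  = here refl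
  select⁺ (x ∷ xs) (there x∈)  Px | yes _  = there (select⁺ xs x∈ Px)
  select⁺ (x ∷ xs) (here refl) Px | no ¬Px = contradiction-irr Px ¬Px
  select⁺ (x ∷ xs) (there x∈)  Px | no _   = select⁺ xs x∈ Px

record FinitePoset a ℓ : Set (lsuc (a ⊔ ℓ)) where
  infix 4 _≤_ _⋖_
  field
    Carrier           : Set a
    _≤_               : Rel Carrier ℓ
    isDecPartialOrder : IsDecPartialOrder _≡_ _≤_
    elements          : List Carrier
    complete          : ∀ x → x List.∈ elements
    unique            : Unique elements

  open IsDecPartialOrder isDecPartialOrder public
    using (_≟_; _≤?_; isPartialOrder; reflexive; antisym) renaming (refl to ≤-refl; trans to ≤-trans)

  open Strict _≡_ _≤_ public using (_<_)

  _<?_ : Decidable _<_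
  _<?_ = Strict.<-decidable _≡_ _≤_ _≟_ _≤?_

  enumeration : Enumeration Carrier
  enumeration = record { elements = elements ; complete = complete }

  open Enumeration enumeration public using (exists?; forall?)

  _⋖_ : Rel Carrier (a ⊔ ℓ)
  x ⋖ y = x < y × ¬ ∃ λ z → x < z × z < y

  _⋖?_ : Decidable _⋖_
  x ⋖? y = (x <? y) ×-dec ¬? (exists? λ z → (x <? z) ×-dec (z <? y))

  private
    at : Fin (List.length elements) → Carrier
    at = List.lookup elements

    position : Carrier → Fin (List.length elements)
    position x = Any.index (complete x)

    at-position : ∀ x → x ≡ at (position x)
    at-position x = lookup-index (complete x)

    isSPO : IsStrictPartialOrder (_≡_ on at) (_<_ on at)
    isSPO = On.isStrictPartialOrder at (Strict.<-isStrictPartialOrder _≡_ _≤_ isPartialOrder)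

  <-wellFounded : WellFounded _<_
  <-wellFounded = Subrelation.wellFounded
    (λ {x} {y} → subst₂ _<_ (at-position x) (at-position y))
    (On.wellFounded position (spo-wellFounded isSPO))

  <-noetherian : WellFounded (flip _<_)
  <-noetherian = Subrelation.wellFounded
    (λ {x} {y} → subst₂ _<_ (at-position y) (at-position x))
    (On.wellFounded position (spo-noetherian isSPO))

mkFinitePoset : {A : Set a} {_≤_ : Rel A ℓ} →
                IsDecPartialOrder _≡_ _≤_ → Enumeration A → FinitePoset a ℓ
mkFinitePoset {A = A} {_≤_ = _≤_} isDPO E = record
  { Carrier           = A
  ; _≤_               = _≤_
  ; isDecPartialOrder = isDPO
  ; elements          = List.deduplicate _≟_ elements
  ; complete          = ∈-deduplicate⁺ _≟_ ∘ complete
  ; unique            = deduplicate-! _≟_ elements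
  }
  where
  open IsDecPartialOrder isDPO using (_≟_)
  open Enumeration E

module Möbius {a ℓ} (P : FinitePoset a ℓ) where
  open FinitePoset P

  ∑ : (Carrier → ℤ) → ℤ
  ∑ f = List.foldr ℤ._+_ 0ℤ (List.map f elements)

  ∑[_≤z<_] : ∀ x y → (∀ z → z < y → ℤ) → ℤ
  ∑[ x ≤z< y ] f = ∑ term
    module ∑-range where
    term : Carrier → ℤ
    term z with x ≤? z | z <? y
    ... | yes _ | yes z<y = f z z<y
    ... | yes _ | no  _   = 0ℤ
    ... | no  _ | _       = 0ℤ

  -- Recursion on the accessibility of y; μ satisfies the usual defining
  -- equations by μ-refl, μ-< and μ-≰ below.
  μ-acc : ∀ x y → Acc _<_ y → ℤ
  μ-acc x y (acc rec) with x ≟ y | x <? y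
  ... | yes _ | _     = 1ℤ
  ... | no  _ | no  _ = 0ℤ
  ... | no  _ | yes _ = ℤ.- ∑[ x ≤z< y ] (λ z z<y → μ-acc x z (rec z<y))

  μ : Carrier → Carrier → ℤ
  μ x y = μ-acc x y (<-wellFounded y)

  private
    sum : List ℤ → ℤ
    sum = List.foldr ℤ._+_ 0ℤ

    ∑-range-cong : ∀ x y {f g} → (∀ z z<y → f z z<y ≡ g z z<y) →
                   ∑[ x ≤z< y ] f ≡ ∑[ x ≤z< y ] g
    ∑-range-cong x y {f} {g} f≗g = cong sum (map-cong term-cong elements)
      where
      term-cong : ∀ z → ∑-range.term x y f z ≡ ∑-range.term x y g z
      term-cong z with x ≤? z | z <? y
      ... | yes _ | yes z<y = f≗g z z<y
      ... | yes _ | no  _   = refl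
      ... | no  _ | _       = refl

    sum-filter : ∀ {P : Pred Carrier p} (P? : U.Decidable P) (f g : Carrier → ℤ) →
                 (∀ z → P z → f z ≡ g z) → (∀ z → ¬ P z → f z ≡ 0ℤ) →
                 ∀ zs → sum (List.map f zs) ≡ sum (List.map g (List.filter P? zs))
    sum-filter P? f g f≡g f≡0 []       = refl
    sum-filter P? f g f≡g f≡0 (z ∷ zs) with P? z
    ... | yes Pz = cong₂ ℤ._+_ (f≡g z Pz) (sum-filter P? f g f≡g f≡0 zs)
    ... | no ¬Pz = trans (cong₂ ℤ._+_ (f≡0 z ¬Pz) (sum-filter P? f g f≡g f≡0 zs)) (ℤ.+-identityˡ _)

    ∑-range-filter : ∀ x y (f : Carrier → ℤ) →
      ∑[ x ≤z< y ] (λ z _ → f z) ≡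
      sum (List.map f (List.filter (λ z → (x ≤? z) ×-dec (z <? y)) elements))
    ∑-range-filter x y f = sum-filter (λ z → (x ≤? z) ×-dec (z <? y)) _ f inside outside elements
      where
      inside : ∀ z → x ≤ z × z < y → ∑-range.term x y (λ z _ → f z) z ≡ f z
      inside z (x≤z , z<y) with x ≤? z | z <? y
      ... | yes _  | yes _  = refl
      ... | yes _  | no z≮y = contradiction-irr z<y z≮y
      ... | no x≰z | _      = contradiction-irr x≤z x≰z

      outside : ∀ z → ¬ (x ≤ z × z < y) → ∑-range.term x y (λ z _ → f z) z ≡ 0ℤ
      outside z ¬p with x ≤? z | z <? y
      ... | yes x≤z | yes z<y = contradiction-irr (x≤z , z<y) ¬p
      ... | yes _   | no _    = refl
      ... | no  _   | _       = refl

    μ-acc-irrelevant : ∀ x y (p q : Acc _<_ y) → μ-acc x y p ≡ μ-acc x y q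
    μ-acc-irrelevant x y (acc p) (acc q) with x ≟ y | x <? y
    ... | yes _ | _     = refl
    ... | no  _ | no  _ = refl
    ... | no  _ | yes _ = cong ℤ.-_ (∑-range-cong x y λ z z<y →
                            μ-acc-irrelevant x z (p z<y) (q z<y))

  μ-refl : ∀ x → μ x x ≡ 1ℤ
  μ-refl x with acc _ ← <-wellFounded x with x ≟ x | x <? x
  ... | yes _   | _ = refl
  ... | no  x≢x | _ = contradiction-irr refl x≢x

  μ-< : ∀ {x y} → x < y →
        μ x y ≡ ℤ.- List.foldr ℤ._+_ 0ℤ
          (List.map (μ x) (List.filter (λ z → (x ≤? z) ×-dec (z <? y)) elements))
  μ-< {x} {y} x<y with <-wellFounded y
  ... | acc rec with x ≟ y | x <? y
  ... | yes x≡y | _       = contradiction-irr x≡y (proj₂ x<y)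
  ... | no _    | no x≮y  = contradiction-irr x<y x≮y
  ... | no _    | yes _   = cong ℤ.-_ (trans
    (∑-range-cong x y λ z z<y → μ-acc-irrelevant x z (rec z<y) (<-wellFounded z))
    (∑-range-filter x y (μ x)))

  μ-≰ : ∀ {x y} → ¬ (x ≤ y) → μ x y ≡ 0ℤ
  μ-≰ {x} {y} x≰y with acc _ ← <-wellFounded y with x ≟ y | x <? y
  ... | yes x≡y | _       = contradiction-irr (reflexive x≡y) x≰y
  ... | no _    | yes x<y = contradiction-irr (proj₁ x<y) x≰y
  ... | no _    | no _    = refl

IsParkingFunction : Pred (Vec ℕ n) _
IsParkingFunction as =
  (∀ i → 1 ℕ.≤ lookup as i) ×
  (∀ i → List.lookup (sort (Vec.toList as)) i ℕ.≤ suc (toℕ i))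

isParkingFunction? : U.Decidable (IsParkingFunction {n})
isParkingFunction? as =
  Fin.all? (λ _ → 1 ℕ.≤? _) ×-dec Fin.all? (λ _ → _ ℕ.≤? _)

PF : ∀ n → ℕ → Pred (Vec ℕ n) _
PF n k as = IsParkingFunction as × k ∉ᵥ as × (∀ j → k ℕ.< j → j ℕ.≤ n → j ∈ᵥ as)

PF? : ∀ n k → U.Decidable (PF n k)
PF? n k as = isParkingFunction? as ×-dec ¬? (k ∈ᵥ? as) ×-dec
  map′ {A = ∀ {j} → j ℕ.< suc n → k ℕ.< j → j ∈ᵥ as}
       (λ f j k<j j≤n → f (s≤s j≤n) k<j)
       (λ f j<1+n k<j → f _ k<j (ℕ.s≤s⁻¹ j<1+n))
       (ℕ.allUpTo? (λ j → (k ℕ.<? j) →-dec (j ∈ᵥ? as)) (suc n))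

-- A partition of Fin m is encoded by the vector whose entry at i is the
-- block containing i.

IsPartition : Pred (Vec (Subset m) m) _
IsPartition v =
  (∀ i → i ∈ lookup v i) ×
  (∀ i j → j ∈ lookup v i → lookup v j ≡ lookup v i)

-- The convex hulls of two disjoint sets of points on a circle meet just
-- when a chord of the first crosses a chord of the second.

IsNoncrossing : Pred (Vec (Subset m) m) _
IsNoncrossing v = ∀ a b c d → a Fin.< b → b Fin.< c → c Fin.< d →
  c ∈ lookup v a → d ∈ lookup v b → b ∈ lookup v a

_≟ₛ_ : DecidableEquality (Subset m)
_≟ₛ_ = ≡-dec Bool._≟_

isPartition? : U.Decidable (IsPartition {m})
isPartition? v =
  Fin.all? (λ i → i ∈? lookup v i) ×-dec
  Fin.all? (λ i → Fin.all? λ j → (j ∈? lookup v i) →-dec (lookup v j ≟ₛ lookup v i))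

isNoncrossing? : U.Decidable (IsNoncrossing {m})
isNoncrossing? v =
  Fin.all? λ a → Fin.all? λ b → Fin.all? λ c → Fin.all? λ d →
  (a Fin.<? b) →-dec (b Fin.<? c) →-dec (c Fin.<? d) →-dec
  (c ∈? lookup v a) →-dec (d ∈? lookup v b) →-dec (b ∈? lookup v a)

NoncrossingPartition : ℕ → Set
NoncrossingPartition m = [ v ∈ Vec (Subset m) m ∣ IsPartition v × IsNoncrossing v ]

block : NoncrossingPartition m → Fin m → Subset m
block π = lookup (value π)

block-injective : {σ τ : NoncrossingPartition m} → (∀ i → block σ i ≡ block τ i) → σ ≡ τ
block-injective {σ = σ} {τ} eq = Refinement.value-injective
  (trans (sym (tabulate∘lookup (value σ))) (trans (tabulate-cong eq) (tabulate∘lookup (value τ))))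

_≼_ : Rel (NoncrossingPartition m) _
σ ≼ τ = ∀ i → block σ i ⊆ block τ i

≼-trans : {σ τ ρ : NoncrossingPartition m} → σ ≼ τ → τ ≼ ρ → σ ≼ ρ
≼-trans σ≼τ τ≼ρ i x∈ = τ≼ρ i (σ≼τ i x∈)

≼-antisym : {σ τ : NoncrossingPartition m} → σ ≼ τ → τ ≼ σ → σ ≡ τ
≼-antisym {σ = σ} {τ} σ≼τ τ≼σ = block-injective λ i →
  ⊆-antisym {i = block σ i} {block τ i} (σ≼τ i) (τ≼σ i)

≼-isDecPartialOrder : IsDecPartialOrder _≡_ (_≼_ {m})
≼-isDecPartialOrder = record
  { isPartialOrder = record
    { isPreorder = record
      { isEquivalence = isEquivalence
      ; reflexive     = λ { refl _ x∈ → x∈ }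
      ; trans         = λ {σ τ ρ} → ≼-trans {σ = σ} {τ} {ρ}
      }
    ; antisym = ≼-antisym
    }
  ; _≟_  = Refinement._≟_ (≡-dec _≟ₛ_)
  ; _≤?_ = λ σ τ → Fin.all? λ i → block σ i ⊆? block τ i
  }

NC : ℕ → FinitePoset _ _
NC m = mkFinitePoset ≼-isDecPartialOrder
  (refinements (λ v → isPartition? v ×-dec isNoncrossing? v) (vecs (vecs bools m) m))

Least Greatest : Pred (Fin m) p → Pred (Fin m) _
Least    P i = P i × (∀ j → P j → i Fin.≤ j)
Greatest P i = P i × (∀ j → P j → j Fin.≤ i)

_∈blocks_ : Subset m → NoncrossingPartition m → Set
B ∈blocks π = ∃ λ i → block π i ≡ B

Label : NoncrossingPartition m → NoncrossingPartition m → Pred (Fin m) _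
Label σ τ l = ∃₂ λ B₁ B₂ →
  B₁ ≢ B₂ × B₁ ∈blocks σ × B₂ ∈blocks σ × (B₁ ∪ B₂) ∈blocks τ ×
  (∃ λ i → Least (_∈ B₁ ∪ B₂) i × i ∈ B₁) ×
  Greatest (λ i → i ∈ B₁ × (∀ j → j ∈ B₂ → i Fin.< j)) l

least? : {P : Pred (Fin m) p} → U.Decidable P → U.Decidable (Least P)
least? P? i = P? i ×-dec Fin.all? (λ j → P? j →-dec (i Fin.≤? j))

greatest? : {P : Pred (Fin m) p} → U.Decidable P → U.Decidable (Greatest P)
greatest? P? i = P? i ×-dec Fin.all? (λ j → P? j →-dec (j Fin.≤? i))

_∈blocks?_ : Decidable (_∈blocks_ {m})
B ∈blocks? π = Fin.any? λ i → block π i ≟ₛ B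

label? : (σ τ : NoncrossingPartition m) → U.Decidable (Label σ τ)
label? σ τ l = anySubset? λ B₁ → anySubset? λ B₂ →
  ¬? (B₁ ≟ₛ B₂) ×-dec (B₁ ∈blocks? σ) ×-dec (B₂ ∈blocks? σ) ×-dec ((B₁ ∪ B₂) ∈blocks? τ) ×-dec
  Fin.any? (λ i → least? (_∈? (B₁ ∪ B₂)) i ×-dec (i ∈? B₁)) ×-dec
  greatest? (λ i → (i ∈? B₁) ×-dec Fin.all? (λ j → (j ∈? B₂) →-dec (i Fin.<? j))) l

module _ (n k : ℕ) where
  private module NC = FinitePoset (NC (suc n))
  open NC using () renaming (_⋖_ to _⋖ᴺ_)

  -- NC (suc n) is graded of rank n, so its maximal chains have n + 1 elements.
  Chain : Set
  Chain = Vec NC.Carrier (suc n)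

  IsMaximalChain : Pred Chain _
  IsMaximalChain c =
    Minimum NC._≤_ (lookup c zero) ×
    Maximum NC._≤_ (lookup c (fromℕ n)) ×
    (∀ i → lookup c (inject₁ i) ⋖ᴺ lookup c (suc i))

  Labels : Chain → Pred (Vec (Fin (suc n)) n) _
  Labels c ls = ∀ i → Label (lookup c (inject₁ i)) (lookup c (suc i)) (lookup ls i)

  -- The index i : Fin (suc n) stands for the number i + 1 in {1, …, n + 1}.
  IsPFChain : Pred Chain _
  IsPFChain c = IsMaximalChain c × ∃ λ ls → Labels c ls × PF n k (Vec.map (suc ∘ toℕ) ls)

  OnPFChain : Pred NC.Carrier _
  OnPFChain π = ∃ λ c → IsPFChain c × ∃ λ i → lookup c i ≡ π

  PFCover : Rel NC.Carrier _
  PFCover σ τ = ∃ λ c → IsPFChain c × ∃ λ i → lookup c (inject₁ i) ≡ σ × lookup c (suc i) ≡ τ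

  isPFChain? : U.Decidable IsPFChain
  isPFChain? c =
    (NC.forall? (λ π → lookup c zero NC.≤? π) ×-dec
     NC.forall? (λ π → π NC.≤? lookup c (fromℕ n)) ×-dec
     Fin.all? (λ i → lookup c (inject₁ i) NC.⋖? lookup c (suc i))) ×-dec
    Enumeration.exists? (vecs fins n) (λ ls →
      Fin.all? (λ i → label? (lookup c (inject₁ i)) (lookup c (suc i)) (lookup ls i)) ×-dec
      PF? n k (Vec.map (suc ∘ toℕ) ls))

  private
    chains : Enumeration Chain
    chains = vecs NC.enumeration (suc n)

  onPFChain? : U.Decidable OnPFChain
  onPFChain? π = Enumeration.exists? chains λ c →
    isPFChain? c ×-dec Fin.any? λ i → lookup c i NC.≟ π

  pfCover? : Decidable PFCover
  pfCover? σ τ = Enumeration.exists? chains λ c →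
    isPFChain? c ×-dec Fin.any? λ i → (lookup c (inject₁ i) NC.≟ σ) ×-dec (lookup c (suc i) NC.≟ τ)

  pfCover⇒< : ∀ {σ τ} → PFCover σ τ → σ NC.< τ
  pfCover⇒< (_ , ((_ , _ , cover) , _) , i , refl , refl) = proj₁ (cover i)

  star⇒≤ : ∀ {σ τ} → Star PFCover σ τ → σ NC.≤ τ
  star⇒≤ {σ} ε = NC.≤-refl {σ}
  star⇒≤ {σ} {τ} (_◅_ {j = ρ} c s) =
    NC.≤-trans {σ} {ρ} {τ} (proj₁ (pfCover⇒< c)) (star⇒≤ s)

  star? : Decidable (Star PFCover)
  star? σ τ = go σ (NC.<-noetherian σ)
    where
    go : ∀ σ → Acc (flip NC._<_) σ → Dec (Star PFCover σ τ)
    go σ (acc rec) with σ NC.≟ τ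
    ... | yes refl = yes ε
    ... | no  σ≢τ  = map′
      (λ (_ , c , s) → c ◅ s)
      (λ { ε → contradiction-irr refl σ≢τ ; (c ◅ s) → _ , c , s })
      (NC.exists? step?)
      where
      step? : ∀ ρ → Dec (PFCover σ ρ × Star PFCover ρ τ)
      step? ρ with pfCover? σ ρ
      ... | no ¬c = no (¬c ∘ proj₁)
      ... | yes c = map′ (c ,_) proj₂ (go ρ (rec (pfCover⇒< c)))

  PosetPF : FinitePoset _ _
  PosetPF = mkFinitePoset {A = [ π ∈ NC.Carrier ∣ OnPFChain π ]} {_≤_ = Star PFCover on value}
    (record
      { isPartialOrder = record
        { isPreorder = record
          { isEquivalence = isEquivalence
          ; reflexive     = λ { refl → ε }
          ; trans         = _◅◅_
          }
        ; antisym = λ s t → Refinement.value-injective (NC.antisym (star⇒≤ s) (star⇒≤ t))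
        }
      ; _≟_  = Refinement._≟_ NC._≟_
      ; _≤?_ = λ x y → star? (value x) (value y)
      })
    (refinements onPFChain? NC.enumeration)

module Submission where

-- Call a partition joined if k and k + 1 lie in a common block. In
-- P = Poset(PF_{n,k}) the value μ(0̂, x) vanishes for every joined x, and 1̂ is
-- joined. By induction on x only the unjoined y ≤ x contribute to μ(0̂, x). Let
-- β be the least element of the block of k in x; since k is never a label, no
-- unjoined y ≤ x has β in the block of k, and merging the blocks of β and k + 1
-- maps the unjoined elements below x to themselves. This is a closure operator
-- that does not fix 0̂, so the values μ(0̂, y) over these y sum to 0.

open import Defs
open import Algebra.Properties.CommutativeSemigroup using (interchange)
open import Data.Bool.Base using (true)
open import Data.Fin.Base as Fin using (Fin; zero; suc; toℕ; fromℕ; inject₁; fromℕ<; cast)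
open import Data.Fin.Induction using (>-wellFounded)
import Data.Fin.Properties as Fin
open import Data.Fin.Subset using (Subset; _∈_; _∪_)
open import Data.Fin.Subset.Properties using (_∈?_; x∈p∪q⁺; x∈p∪q⁻; ⊆-antisym)
open import Data.Integer.Base as ℤ using (ℤ; 0ℤ)
import Data.Integer.Properties as ℤ
open import Data.Irrelevant using ([_])
open import Data.List.Base as List using (List; []; _∷_)
import Data.List.Membership.Propositional as List
open import Data.List.Properties using (map-cong)
open import Data.List.Relation.Binary.Permutation.Homogeneous using (onIndices)
open import Data.List.Relation.Binary.Permutation.Propositional using (↭⇒↭ₛ)
open import Data.List.Relation.Binary.Permutation.Propositional.Properties using (↭-length)
import Data.List.Relation.Binary.Permutation.Setoid.Properties as Permutation
open import Data.List.Relation.Unary.All as All using (All; []; _∷_)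
open import Data.List.Relation.Unary.AllPairs using ([]; _∷_)
open import Data.List.Relation.Unary.Any using (here; there)
open import Data.List.Relation.Unary.Sorted.TotalOrder.Properties using (lookup-mono-≤)
open import Data.List.Relation.Unary.Unique.Propositional using (Unique)
open import Data.Nat.Base as ℕ using (ℕ; zero; suc; s≤s; z≤n; _<_; _≤_)
import Data.Nat.Properties as ℕ
open import Data.List.Sort ℕ.≤-decTotalOrder using (sort; sort-↭; sort-↗)
open import Data.Product.Base using (∃; ∃₂; _×_; _,_; proj₁; proj₂)
open import Data.Refinement using (_,_; value)
open import Data.Sum.Base as Sum using (_⊎_; inj₁; inj₂)
open import Data.Unit.Base using (⊤; tt)
open import Data.Vec.Base as Vec using (Vec; []; _∷_; lookup; tabulate)
open import Data.Vec.Membership.Propositional using () renaming (_∈_ to _∈ᵥ_)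
open import Data.Vec.Membership.Propositional.Properties using (∈-lookup)
open import Data.Vec.Properties
  using (lookup∘tabulate; tabulate-cong; lookup⇒[]=; []=⇒lookup; lookup-map; length-toList)
import Data.Vec.Relation.Unary.Any as Any
open import Data.Vec.Relation.Unary.Any.Properties using (lookup-index)
open import Function.Base using (_∘_; flip; id)
open import Function.Bundles using (Inverse; Injection; mk⇔)
open import Function.Definitions using (Injective)
open import Function.Properties.Inverse using (↔⇒↣)
open import Induction.WellFounded using (Acc; acc)
open import Level using (Level; 0ℓ)
open import Relation.Binary.Construct.Closure.ReflexiveTransitive
  using (Star; ε; _◅_; _◅◅_; gmap; fold)
open import Relation.Binary.Core using (Rel)
open import Relation.Binary.Definitions
  using (Decidable; Minimum; Maximum; Reflexive; Transitive; tri<; tri≈; tri>)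
open import Relation.Binary.PropositionalEquality
open import Relation.Binary.Structures using (IsEquivalence)
open import Relation.Nullary
  using (¬_; Dec; yes; no; ¬?; _×-dec_; _⊎-dec_; _→-dec_; does; contradiction)
open import Relation.Nullary.Decidable using (decidable-stable; dec-true; does-⇔; map′; recompute)
open import Relation.Unary as U using (Pred)

-- The order of P is given by whole labelled chains, so neither membership in P nor comparability is
-- a local condition. Most of the work replaces them by local ones: `Good` for partitions and `_↝_`
-- for pairs, together with a proof that any `_↝_` between good partitions is filled by covers lying
-- on complete chains.
--
-- The wrapping element arises as follows. Suppose a cover joins k to k + 1 with k in `B₁` and k + 1
-- in `B₂`. Noncrossing forces the minimum of `B₂` above k, so it is k + 1 and the label is k, which
-- is excluded. Hence k + 1 lies in `B₁`, whose minimum is below the whole block of k. This is why β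
-- stays out of the block of k until k and k + 1 are joined, and why adding β to the block of k + 1
-- leaves the partition unjoined.
--
-- Below an unjoined partition `_↝_` is plain refinement. Merging β with k + 1 therefore gives the
-- least closed element above y among the unjoined ones, which a closure operator needs.

private
  variable
    p q : Level
    m : ℕ
    A : Set p
    B : Set q

-- Sums of Möbius values

when : Dec A → ℤ → ℤ
when (yes _) v = v
when (no  _) v = 0ℤ

when-yes : ∀ (A? : Dec A) {v} → A → when A? v ≡ v
when-yes (yes _) a = refl
when-yes (no ¬a) a = contradiction a ¬a

when-no : ∀ (A? : Dec A) {v} → ¬ A → when A? v ≡ 0ℤ
when-no (yes a) ¬a = contradiction a ¬a
when-no (no _)  ¬a = refl

when-⇔ : ∀ (A? : Dec A) (B? : Dec B) {v} →
         (A → B) → (B → A) → when A? v ≡ when B? v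
when-⇔ (yes a) B? A⇒B B⇒A = sym (when-yes B? (A⇒B a))
when-⇔ (no ¬a) B? A⇒B B⇒A = sym (when-no B? (¬a ∘ B⇒A))

sum : List ℤ → ℤ
sum = List.foldr ℤ._+_ 0ℤ

sum-zero : ∀ {f : A → ℤ} → (∀ z → f z ≡ 0ℤ) → ∀ zs → sum (List.map f zs) ≡ 0ℤ
sum-zero f≡0 []       = refl
sum-zero f≡0 (z ∷ zs) = cong₂ ℤ._+_ (f≡0 z) (sum-zero f≡0 zs)

sum-+ : ∀ (f g : A → ℤ) zs →
        sum (List.map (λ z → f z ℤ.+ g z) zs) ≡ sum (List.map f zs) ℤ.+ sum (List.map g zs)
sum-+ f g []       = refl
sum-+ f g (z ∷ zs) = trans (cong (ℤ._+_ (f z ℤ.+ g z)) (sum-+ f g zs))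
  (interchange ℤ.+-commutativeSemigroup (f z) (g z) _ _)

sum-swap : ∀ (f : A → A → ℤ) ys zs →
           sum (List.map (λ y → sum (List.map (f y) zs)) ys) ≡
           sum (List.map (λ z → sum (List.map (λ y → f y z) ys)) zs)
sum-swap f []       zs = sym (sum-zero (λ _ → refl) zs)
sum-swap f (y ∷ ys) zs =
  trans (cong (ℤ._+_ (sum (List.map (f y) zs))) (sum-swap f ys zs)) (sym (sum-+ (f y) _ zs))

sum-filter : ∀ {Q : Pred A q} (Q? : U.Decidable Q) (f : A → ℤ) zs →
             sum (List.map f (List.filter Q? zs)) ≡ sum (List.map (λ z → when (Q? z) (f z)) zs)
sum-filter Q? f []       = refl
sum-filter Q? f (z ∷ zs) with Q? z
... | yes _ = cong (ℤ._+_ (f z)) (sum-filter Q? f zs)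
... | no  _ = trans (sum-filter Q? f zs) (sym (ℤ.+-identityˡ _))

sum-single : ∀ (f : A → ℤ) x → (∀ z → z ≢ x → f z ≡ 0ℤ) →
             ∀ {zs} → Unique zs → x List.∈ zs → sum (List.map f zs) ≡ f x
sum-single f x f≡0 (x∉zs ∷ _) (here refl) =
  trans (cong (ℤ._+_ (f x)) (zero-on x∉zs)) (ℤ.+-identityʳ _)
  where
  zero-on : ∀ {zs} → All (x ≢_) zs → sum (List.map f zs) ≡ 0ℤ
  zero-on []            = refl
  zero-on (x≢z ∷ x∉zs) = cong₂ ℤ._+_ (f≡0 _ (x≢z ∘ sym)) (zero-on x∉zs)
sum-single f x f≡0 (z∉zs ∷ zs!) (there x∈zs) =
  trans (cong₂ ℤ._+_ (f≡0 _ λ { refl → contradiction refl (All.lookup z∉zs x∈zs) })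
                     (sum-single f x f≡0 zs! x∈zs))
        (ℤ.+-identityˡ _)

module _ {a ℓ} (P : FinitePoset a ℓ) where
  open FinitePoset P renaming (_≤_ to _≤ᴾ_; _<_ to _<ᴾ_)
  open Möbius P

  ∑-single : ∀ (f : Carrier → ℤ) x → (∀ z → z ≢ x → f z ≡ 0ℤ) → ∑ f ≡ f x
  ∑-single f x f≡0 = sum-single f x f≡0 unique (complete x)

  ∑-cong : ∀ {f g : Carrier → ℤ} → (∀ z → f z ≡ g z) → ∑ f ≡ ∑ g
  ∑-cong f≗g = cong sum (map-cong f≗g elements)

  ∑-zero : ∀ {f : Carrier → ℤ} → (∀ z → f z ≡ 0ℤ) → ∑ f ≡ 0ℤ
  ∑-zero f≡0 = sum-zero f≡0 elements

  ∑-split : ∀ (f g : Carrier → ℤ) → ∑ (λ z → f z ℤ.+ g z) ≡ ∑ f ℤ.+ ∑ g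
  ∑-split f g = sum-+ f g elements

  ∑-swap : ∀ (f : Carrier → Carrier → ℤ) → ∑ (λ y → ∑ (f y)) ≡ ∑ (λ z → ∑ λ y → f y z)
  ∑-swap f = sum-swap f elements elements

  ≤∧≮⇒≡ : ∀ {x y} → x ≤ᴾ y → ¬ (x <ᴾ y) → x ≡ y
  ≤∧≮⇒≡ {x} {y} x≤y x≮y with x ≟ y
  ... | yes x≡y = x≡y
  ... | no  x≢y = contradiction (x≤y , x≢y) x≮y

  module _ {0̂ : Carrier} (0̂-min : Minimum _≤ᴾ_ 0̂) where

    μ-below : ∀ {x} → x ≢ 0̂ → μ 0̂ x ≡ ℤ.- ∑ λ z → when (z <? x) (μ 0̂ z)
    μ-below {x} x≢0̂ = trans (μ-< (0̂-min x , x≢0̂ ∘ sym)) (cong ℤ.-_ (trans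
      (sum-filter (λ z → (0̂ ≤? z) ×-dec (z <? x)) (μ 0̂) elements)
      (∑-cong λ z → when-⇔ ((0̂ ≤? z) ×-dec (z <? x)) (z <? x) proj₂ (0̂-min z ,_))))

    ∑-below-split : ∀ x (f : Carrier → ℤ) →
      ∑ (λ z → when (z ≤? x) (f z)) ≡ f x ℤ.+ ∑ λ z → when (z <? x) (f z)
    ∑-below-split x f = trans
      (trans (∑-cong split) (∑-split (λ z → when (z ≟ x) (f z)) (λ z → when (z <? x) (f z))))
      (cong (ℤ._+ ∑ (λ z → when (z <? x) (f z))) (trans
        (∑-single _ x (λ z z≢x → when-no (z ≟ x) z≢x))
        (when-yes (x ≟ x) refl)))
      where
      split : ∀ z → when (z ≤? x) (f z) ≡ when (z ≟ x) (f z) ℤ.+ when (z <? x) (f z)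
      split z = case (z ≟ x) (z <? x)
        where
        case : Dec (z ≡ x) → Dec (z <ᴾ x) → _
        case (yes z≡x) _ = trans (when-yes (z ≤? x) (reflexive z≡x)) (sym (trans
          (cong₂ ℤ._+_ (when-yes (z ≟ x) z≡x) (when-no (z <? x) λ z<x → proj₂ z<x z≡x))
          (ℤ.+-identityʳ _)))
        case (no z≢x) (yes z<x) = trans (when-yes (z ≤? x) (proj₁ z<x)) (sym (trans
          (cong₂ ℤ._+_ (when-no (z ≟ x) z≢x) (when-yes (z <? x) z<x))
          (ℤ.+-identityˡ _)))
        case (no z≢x) (no z≮x) = trans (when-no (z ≤? x) λ z≤x → z≢x (≤∧≮⇒≡ z≤x z≮x)) (sym
          (cong₂ ℤ._+_ (when-no (z ≟ x) z≢x) (when-no (z <? x) z≮x)))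

    ∑-below-μ : ∀ {x} → x ≢ 0̂ → ∑ (λ z → when (z ≤? x) (μ 0̂ z)) ≡ 0ℤ
    ∑-below-μ {x} x≢0̂ = trans (∑-below-split x (μ 0̂))
      (trans (cong (ℤ._+ s) (μ-below x≢0̂)) (ℤ.+-inverseˡ s))
      where
      s : ℤ
      s = ∑ λ z → when (z <? x) (μ 0̂ z)

    -- For a closed z the elements of I below z are those whose closure is
    -- below z, so by induction on z the fibre of the closure over z has total
    -- weight 0; summing over the closed z gives the claim.
    module _ {i c} {I : Pred Carrier i} {C : Pred Carrier c}
             (I? : U.Decidable I) (I-down : ∀ {x y} → x ≤ᴾ y → I y → I x)
             (0̂∉C : ¬ C 0̂)
             (closure : ∀ {y} → I y → ∃ λ z → (I z × C z) × y ≤ᴾ z ×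
                          (∀ {w} → I w → C w → y ≤ᴾ w → z ≤ᴾ w)) where

      private
        cl : Carrier → Carrier
        cl y with I? y
        ... | yes Iy = proj₁ (closure Iy)
        -- A default value outside I; every use of `cl` is guarded by membership in I.
        ... | no  _  = y

        cl-closure : ∀ {y} → I y → (I (cl y) × C (cl y)) × y ≤ᴾ cl y ×
                     (∀ {w} → I w → C w → y ≤ᴾ w → cl y ≤ᴾ w)
        cl-closure {y} Iy with I? y
        ... | yes Iy′ = proj₂ (closure Iy′)
        ... | no ¬Iy  = contradiction Iy ¬Iy

        cl-≥ : ∀ {y} → I y → y ≤ᴾ cl y
        cl-≥ = proj₁ ∘ proj₂ ∘ cl-closure

        cl-least : ∀ {y z} → I y → I z → C z → y ≤ᴾ z → cl y ≤ᴾ z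
        cl-least Iy = proj₂ (proj₂ (cl-closure Iy))

        fibre : Carrier → ℤ
        fibre z = ∑ λ y → when (I? y ×-dec (cl y ≟ z)) (μ 0̂ y)

        -- Exchanging the two sums leaves, for each y in I, only the term z = `cl y`. It serves both
        -- for the elements below a closed z and, with the trivial predicate, for all of I.
        ∑-fibres : ∀ {q} {Q : Pred Carrier q} (Q? : U.Decidable Q) →
          ∑ (λ z → when (Q? z) (fibre z)) ≡ ∑ (λ y → when (I? y ×-dec Q? (cl y)) (μ 0̂ y))
        ∑-fibres Q? = trans (∑-cong λ z → pull (Q? z)) (trans (∑-swap _) (∑-cong λ y → trans
          (∑-single _ (cl y) λ z z≢ →
            when-no (Q? z ×-dec I? y ×-dec (cl y ≟ z)) λ p → z≢ (sym (proj₂ (proj₂ p))))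
          (when-⇔ (Q? (cl y) ×-dec I? y ×-dec (cl y ≟ cl y)) (I? y ×-dec Q? (cl y))
            (λ p → proj₁ (proj₂ p) , proj₁ p) (λ p → proj₂ p , proj₁ p , refl))))
          where
          pull : ∀ {z} {q} {Q : Set q} (Q? : Dec Q) →
                 when Q? (fibre z) ≡ ∑ λ y → when (Q? ×-dec I? y ×-dec (cl y ≟ z)) (μ 0̂ y)
          pull {z} (yes q) = ∑-cong λ y →
            when-⇔ (I? y ×-dec (cl y ≟ z)) (yes q ×-dec I? y ×-dec (cl y ≟ z)) (q ,_) proj₂
          pull {z} (no ¬q) = sym (∑-zero λ _ → refl)

        fibre-zero : ∀ z → Acc _<ᴾ_ z → fibre z ≡ 0ℤ
        fibre-zero z (acc rec) with exists? (λ y → I? y ×-dec (cl y ≟ z))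
        ... | no ∄y = ∑-zero λ y → when-no (I? y ×-dec (cl y ≟ z)) λ p → ∄y (y , p)
        -- A nonempty fibre makes z the closure of some x in I, so z lies in I, is closed, and
        -- differs from 0̂.
        ... | yes (x , Ix , refl) = begin
          fibre z
            ≡⟨ ℤ.+-identityʳ _ ⟨
          fibre z ℤ.+ 0ℤ
            ≡⟨ cong (ℤ._+_ (fibre z)) (∑-zero below-zero) ⟨
          fibre z ℤ.+ ∑ (λ w → when (w <? z) (fibre w))
            ≡⟨ ∑-below-split z fibre ⟨
          ∑ (λ w → when (w ≤? z) (fibre w))
            ≡⟨ ∑-fibres (_≤? z) ⟩
          ∑ (λ y → when (I? y ×-dec (cl y ≤? z)) (μ 0̂ y))
            ≡⟨ ∑-cong (λ y → when-⇔ (I? y ×-dec (cl y ≤? z)) (y ≤? z)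
                 (λ (Iy , cly≤z) → ≤-trans (cl-≥ Iy) cly≤z)
                 (λ y≤z → I-down y≤z Iz , cl-least (I-down y≤z Iz) Iz Cz y≤z)) ⟩
          ∑ (λ y → when (y ≤? z) (μ 0̂ y))
            ≡⟨ ∑-below-μ (λ z≡0̂ → 0̂∉C (subst C z≡0̂ Cz)) ⟩
          0ℤ ∎
          where
          open ≡-Reasoning
          Iz : I (cl x)
          Iz = proj₁ (proj₁ (cl-closure Ix))
          Cz : C (cl x)
          Cz = proj₂ (proj₁ (cl-closure Ix))
          below-zero : ∀ w → when (w <? z) (fibre w) ≡ 0ℤ
          below-zero w with w <? z
          ... | yes w<z = fibre-zero w (rec w<z)
          ... | no  _   = refl

      ∑-closure : ∑ (λ y → when (I? y) (μ 0̂ y)) ≡ 0ℤ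
      ∑-closure = trans (sym (trans (∑-fibres (λ _ → yes (refl {x = 0ℤ})))
          (∑-cong λ y → when-⇔ (I? y ×-dec yes refl) (I? y) proj₁ (_, refl))))
        (∑-zero λ z → fibre-zero z (<-wellFounded z))

-- Parking functions

cast-injective : ∀ {m n} (eq : m ≡ n) → Injective _≡_ _≡_ (cast eq)
cast-injective eq {i} {j} p = Fin.toℕ-injective
  (trans (sym (Fin.toℕ-cast eq i)) (trans (cong toℕ p) (Fin.toℕ-cast eq j)))

lookup-toList : ∀ {a} {A : Set a} {n} (xs : Vec A n) i →
                List.lookup (Vec.toList xs) i ≡ lookup xs (cast (length-toList xs) i)
lookup-toList (x ∷ xs) zero    = refl
lookup-toList (x ∷ xs) (suc i) = lookup-toList xs i

-- Otherwise f would inject the m - i positions from i on into the n - i - 1 values above i, against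
-- n ≤ m.
injective⇒∃≤ : ∀ {m n} {f : Fin m → Fin n} → Injective _≡_ _≡_ f → n ≤ m →
               ∀ i → ∃ λ j → i Fin.≤ j × toℕ (f j) ≤ toℕ i
injective⇒∃≤ {m} {n} {f} f-inj n≤m i
  with Fin.any? (λ j → (i Fin.≤? j) ×-dec (toℕ (f j) ℕ.≤? toℕ i))
... | yes ∃j = ∃j
... | no ¬∃j = contradiction (Fin.injective⇒≤ {f = g} g-inj) (ℕ.<⇒≱ (ℕ.≤-<-trans
        (ℕ.∸-monoˡ-≤ (suc (toℕ i)) n≤m) (ℕ.∸-monoʳ-< (ℕ.n<1+n (toℕ i)) (Fin.toℕ<n i))))
  where
  i+<m : ∀ (j : Fin (m ℕ.∸ toℕ i)) → toℕ i ℕ.+ toℕ j < m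
  i+<m j = subst (toℕ i ℕ.+ toℕ j <_) (ℕ.m+[n∸m]≡n (ℕ.<⇒≤ (Fin.toℕ<n i)))
    (ℕ.+-monoʳ-< (toℕ i) (Fin.toℕ<n j))

  i+ : Fin (m ℕ.∸ toℕ i) → Fin m
  i+ j = fromℕ< (i+<m j)

  i<f : ∀ j → toℕ i < toℕ (f (i+ j))
  i<f j = ℕ.≰⇒> λ fj≤i → ¬∃j (i+ j ,
    subst (toℕ i ≤_) (sym (Fin.toℕ-fromℕ< (i+<m j))) (ℕ.m≤m+n (toℕ i) (toℕ j)) , fj≤i)

  f-i<n-i : ∀ j → toℕ (f (i+ j)) ℕ.∸ suc (toℕ i) < n ℕ.∸ suc (toℕ i)
  f-i<n-i j = ℕ.∸-monoˡ-< (Fin.toℕ<n (f (i+ j))) (i<f j)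

  g : Fin (m ℕ.∸ toℕ i) → Fin (n ℕ.∸ suc (toℕ i))
  g j = fromℕ< (f-i<n-i j)

  g-inj : Injective _≡_ _≡_ g
  g-inj {j} {k} gj≡gk = Fin.toℕ-injective (ℕ.+-cancelˡ-≡ (toℕ i) (toℕ j) (toℕ k)
    (Fin.fromℕ<-injective _ _ (i+<m j) (i+<m k) (f-inj (Fin.toℕ-injective
      (ℕ.∸-cancelʳ-≡ (i<f j) (i<f k)
        (Fin.fromℕ<-injective _ _ (f-i<n-i j) (f-i<n-i k) gj≡gk))))))

-- By the pigeonhole principle: among the entries from position i of the sorted
-- vector on, some entry has f ≤ i, and it bounds the i-th entry.
dominated⇒isParkingFunction : ∀ {n} (as : Vec ℕ n) (f : Fin n → Fin n) → Injective _≡_ _≡_ f →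
  (∀ i → 1 ≤ lookup as i) → (∀ i → lookup as i ≤ suc (toℕ (f i))) → IsParkingFunction as
dominated⇒isParkingFunction {n} as f f-inj 1≤as as≤f =
  1≤as , λ i → bound i (injective⇒∃≤ (position-inj ∘ f-inj) n≤ i)
  where
  as↭ = sort-↭ (Vec.toList as)
  as↭ₛ = ↭⇒↭ₛ as↭
  σ = onIndices as↭ₛ

  position : Fin (List.length (sort (Vec.toList as))) → Fin n
  position = cast (length-toList as) ∘ Inverse.to σ

  position-inj : Injective _≡_ _≡_ position
  position-inj = Injection.injective (↔⇒↣ σ) ∘ cast-injective (length-toList as)

  lookup-position : ∀ j → List.lookup (sort (Vec.toList as)) j ≡ lookup as (position j)
  lookup-position j = trans (Permutation.onIndices-lookup (setoid ℕ) as↭ₛ j)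
    (lookup-toList as (Inverse.to σ j))

  n≤ : n ≤ List.length (sort (Vec.toList as))
  n≤ = ℕ.≤-reflexive (sym (trans (↭-length as↭) (length-toList as)))

  bound : ∀ i → (∃ λ j → i Fin.≤ j × toℕ (f (position j)) ≤ toℕ i) →
          List.lookup (sort (Vec.toList as)) i ≤ suc (toℕ i)
  bound i (j , i≤j , f≤i) = begin
    List.lookup (sort (Vec.toList as)) i
      ≤⟨ lookup-mono-≤ ℕ.≤-totalOrder (sort-↗ (Vec.toList as)) i≤j ⟩
    List.lookup (sort (Vec.toList as)) j
      ≡⟨ lookup-position j ⟩
    lookup as (position j)
      ≤⟨ as≤f (position j) ⟩
    suc (toℕ (f (position j)))
      ≤⟨ s≤s f≤i ⟩
    suc (toℕ i) ∎
    where open ℕ.≤-Reasoning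

-- Merging blocks of noncrossing partitions

∃⇒∃least : {P : Pred (Fin m) p} → U.Decidable P → ∃ P → ∃ (Least P)
∃⇒∃least {m = suc m} P? (i , Pi) with P? zero
... | yes P0 = zero , P0 , λ _ _ → z≤n
∃⇒∃least {m = suc m} P? (zero , P0) | no ¬P0 = contradiction P0 ¬P0
∃⇒∃least {m = suc m} P? (suc i , Pi) | no ¬P0 with ∃⇒∃least (P? ∘ suc) (i , Pi)
... | j , Pj , j≤ = suc j , Pj , λ { zero P0 → contradiction P0 ¬P0 ; (suc i) Pi → s≤s (j≤ i Pi) }

∃⇒∃greatest : {P : Pred (Fin m) p} → U.Decidable P → ∃ P → ∃ (Greatest P)
∃⇒∃greatest {m = suc m} P? (i , Pi) with Fin.any? (P? ∘ suc)
... | yes ∃P with ∃⇒∃greatest (P? ∘ suc) ∃P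
...   | j , Pj , ≤j = suc j , Pj , λ { zero _ → z≤n ; (suc i) Pi → s≤s (≤j i Pi) }
∃⇒∃greatest {m = suc m} P? (zero , P0) | no ∄P =
  zero , P0 , λ { zero _ → z≤n ; (suc i) Pi → contradiction (i , Pi) ∄P }
∃⇒∃greatest {m = suc m} P? (suc i , Pi) | no ∄P = contradiction (i , Pi) ∄P

infix 4 _⊢_∼_ _⊢_∼?_ _⊑_

-- A record, so that π, x and y can be inferred from its type.
record _⊢_∼_ (π : NoncrossingPartition m) (x y : Fin m) : Set where
  constructor same
  field member : y ∈ block π x

open _⊢_∼_ public

_⊢_∼?_ : (π : NoncrossingPartition m) → Decidable (π ⊢_∼_)
π ⊢ x ∼? y = map′ same member (y ∈? block π x)

_⊑_ : Rel (NoncrossingPartition m) _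
σ ⊑ τ = ∀ {x y} → σ ⊢ x ∼ y → τ ⊢ x ∼ y

isPartition : (π : NoncrossingPartition m) → IsPartition (value π)
isPartition (v , [ p ]) = recompute (isPartition? v) (proj₁ p)

isNoncrossing : (π : NoncrossingPartition m) → IsNoncrossing (value π)
isNoncrossing (v , [ p ]) = recompute (isNoncrossing? v) (proj₂ p)

⊑⇒≼ : {σ τ : NoncrossingPartition m} → σ ⊑ τ → σ ≼ τ
⊑⇒≼ σ⊑τ x y∈ = member (σ⊑τ (same y∈))

≼⇒⊑ : {σ τ : NoncrossingPartition m} → σ ≼ τ → σ ⊑ τ
≼⇒⊑ σ≼τ {x} (same y∈) = same (σ≼τ x y∈)

⊑-antisym : {σ τ : NoncrossingPartition m} → σ ⊑ τ → τ ⊑ σ → σ ≡ τ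
⊑-antisym {σ = σ} {τ} σ⊑τ τ⊑σ = ≼-antisym (⊑⇒≼ {σ = σ} {τ} σ⊑τ) (⊑⇒≼ {σ = τ} {σ} τ⊑σ)

module _ {π : NoncrossingPartition m} where

  block-≡ : ∀ {x y} → π ⊢ x ∼ y → block π y ≡ block π x
  block-≡ (same y∈) = proj₂ (isPartition π) _ _ y∈

  ∼-refl : ∀ {x} → π ⊢ x ∼ x
  ∼-refl = same (proj₁ (isPartition π) _)

  ∼-sym : ∀ {x y} → π ⊢ x ∼ y → π ⊢ y ∼ x
  ∼-sym x∼y = same (subst (_ ∈_) (sym (block-≡ x∼y)) (member ∼-refl))

  ∼-trans : ∀ {x y z} → π ⊢ x ∼ y → π ⊢ y ∼ z → π ⊢ x ∼ z
  ∼-trans x∼y (same z∈) = same (subst (_ ∈_) (block-≡ x∼y) z∈)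

  noncrossing : ∀ {a b c d} → a Fin.< b → b Fin.< c → c Fin.< d →
                π ⊢ a ∼ c → π ⊢ b ∼ d → π ⊢ a ∼ b
  noncrossing a<b b<c c<d (same c∈) (same d∈) = same (isNoncrossing π _ _ _ _ a<b b<c c<d c∈ d∈)

  ∼-cross : ∀ {p q u v} → π ⊢ p ∼ q → p Fin.< u → u Fin.< q → π ⊢ u ∼ v →
            π ⊢ p ∼ u ⊎ (p Fin.< v × v Fin.< q)
  ∼-cross {p} {q} {u} {v} p∼q p<u u<q u∼v with Fin.<-cmp p v | Fin.<-cmp v q
  ... | tri> _ _ v<p  | _             =
    inj₁ (∼-trans (∼-sym (noncrossing v<p p<u u<q (∼-sym u∼v) p∼q)) (∼-sym u∼v))
  ... | tri≈ _ refl _ | _             = inj₁ (∼-sym u∼v)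
  ... | _             | tri≈ _ refl _ = inj₁ (∼-trans p∼q (∼-sym u∼v))
  ... | _             | tri> _ _ q<v  = inj₁ (noncrossing p<u u<q q<v p∼q u∼v)
  ... | tri< p<v _ _  | tri< v<q _ _  = inj₂ (p<v , v<q)

module _ {R : Rel (Fin m) 0ℓ} (R? : Decidable R) (R-equiv : IsEquivalence R)
         (R-nc : ∀ {a b c d} → a Fin.< b → b Fin.< c → c Fin.< d → R a c → R b d → R a b) where
  private
    module R = IsEquivalence R-equiv

    row : Fin m → Subset m
    row x = tabulate λ y → does (R? x y)

    vec : Vec (Subset m) m
    vec = tabulate row

    ∈⁺ : ∀ {x y} → R x y → y ∈ lookup vec x
    ∈⁺ {x} {y} Rxy = subst (y ∈_) (sym (lookup∘tabulate row x))
      (lookup⇒[]= y (row x) (trans (lookup∘tabulate _ y) (dec-true (R? x y) Rxy)))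

    ∈⁻ : ∀ {x y} → y ∈ lookup vec x → R x y
    ∈⁻ {x} {y} y∈ = does⁻ (R? x y) (trans (sym (lookup∘tabulate _ y))
      ([]=⇒lookup (subst (y ∈_) (lookup∘tabulate row x) y∈)))
      where
      does⁻ : ∀ {a} {A : Set a} (A? : Dec A) → does A? ≡ true → A
      does⁻ (yes a) _ = a

    row-≡ : ∀ x y → R x y → lookup vec y ≡ lookup vec x
    row-≡ x y Rxy = trans (lookup∘tabulate row y) (trans
      (tabulate-cong λ z → does-⇔ (mk⇔ (R.trans Rxy) (R.trans (R.sym Rxy))) (R? y z) (R? x z))
      (sym (lookup∘tabulate row x)))

  abstract
    fromEquivalence : NoncrossingPartition m
    fromEquivalence = vec , [ ((λ _ → ∈⁺ R.refl) , (λ x y → row-≡ x y ∘ ∈⁻)) ,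
      (λ _ _ _ _ a<b b<c c<d c∈ d∈ → ∈⁺ (R-nc a<b b<c c<d (∈⁻ c∈) (∈⁻ d∈))) ]

    fromEquivalence⁺ : ∀ {x y} → R x y → fromEquivalence ⊢ x ∼ y
    fromEquivalence⁺ = same ∘ ∈⁺

    fromEquivalence⁻ : ∀ {x y} → fromEquivalence ⊢ x ∼ y → R x y
    fromEquivalence⁻ = ∈⁻ ∘ member

-- If a chord around i that misses the blocks of i and j always goes around j
-- too, no other block separates i from j, so their blocks may be merged.
Linked : NoncrossingPartition m → Fin m → Fin m → Set
Linked π i j = ∀ {p q} → π ⊢ p ∼ q → p Fin.< i → i Fin.< q →
  π ⊢ p ∼ i ⊎ π ⊢ p ∼ j ⊎ (p Fin.< j × j Fin.< q)

-- The equivalence generated by π and the pair i, j: one passage between the two blocks always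
-- suffices.
Joined : NoncrossingPartition m → Fin m → Fin m → Rel (Fin m) 0ℓ
Joined π i j x y = π ⊢ x ∼ y ⊎ (π ⊢ x ∼ i × π ⊢ j ∼ y) ⊎ (π ⊢ x ∼ j × π ⊢ i ∼ y)

-- A relation rather than a function, so that a given τ can be recognised as a merge. If i and j
-- already share a block, then τ is σ; `Wrapping` allows this case.
record Merge (σ : NoncrossingPartition m) (i j : Fin m) (τ : NoncrossingPartition m) : Set where
  field
    extend : σ ⊑ τ
    joined : τ ⊢ i ∼ j
    split  : ∀ {x y} → τ ⊢ x ∼ y → Joined σ i j x y

open Merge public

merge-least : {σ ρ τ : NoncrossingPartition m} {i j : Fin m} →
              Merge σ i j ρ → σ ⊑ τ → τ ⊢ i ∼ j → ρ ⊑ τ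
merge-least σ→ρ σ⊑τ i∼j x∼y with split σ→ρ x∼y
... | inj₁ xy               = σ⊑τ xy
... | inj₂ (inj₁ (xi , jy)) = ∼-trans (σ⊑τ xi) (∼-trans i∼j (σ⊑τ jy))
... | inj₂ (inj₂ (xj , iy)) = ∼-trans (σ⊑τ xj) (∼-trans (∼-sym i∼j) (σ⊑τ iy))

module _ {m} {π : NoncrossingPartition m} where

  -- This handles the crossings that merging could create: a chord p, q of π against a new pair u,
  -- v. The chord surrounds u, hence i, hence by `link` also j, and so it would surround v, unless
  -- it belongs to one of the two merged blocks.
  separated : ∀ {i j} → Linked π i j → ∀ {p q u v} → π ⊢ p ∼ q → p Fin.< u → u Fin.< q →
              π ⊢ u ∼ i → π ⊢ j ∼ v → ¬ (p Fin.< v × v Fin.< q) → π ⊢ p ∼ i ⊎ π ⊢ p ∼ j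
  separated link p∼q p<u u<q u∼i j∼v outside with ∼-cross p∼q p<u u<q u∼i
  ... | inj₁ p∼u         = inj₁ (∼-trans p∼u u∼i)
  ... | inj₂ (p<i , i<q) with link p∼q p<i i<q
  ...   | inj₁ p∼i                = inj₁ p∼i
  ...   | inj₂ (inj₁ p∼j)         = inj₂ p∼j
  ...   | inj₂ (inj₂ (p<j , j<q)) =
    inj₂ (Sum.fromInj₁ (λ inside → contradiction inside outside) (∼-cross p∼q p<j j<q j∼v))

  abstract
    merge : ∀ {i j} → Linked π i j → Linked π j i → ∃ (Merge π i j)
    merge {i} {j} link link′ = fromEquivalence R? R-equiv R-nc , record
      { extend = fromEquivalence⁺ R? R-equiv R-nc ∘ inj₁
      ; joined = fromEquivalence⁺ R? R-equiv R-nc (inj₂ (inj₁ (∼-refl , ∼-refl)))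
      ; split  = fromEquivalence⁻ R? R-equiv R-nc
      }
      where
      R : Rel (Fin m) 0ℓ
      R = Joined π i j

      R? : Decidable R
      R? x y = (π ⊢ x ∼? y) ⊎-dec ((π ⊢ x ∼? i) ×-dec (π ⊢ j ∼? y)) ⊎-dec
               ((π ⊢ x ∼? j) ×-dec (π ⊢ i ∼? y))

      R-trans : ∀ {x y z} → R x y → R y z → R x z
      R-trans (inj₁ xy) (inj₁ yz) = inj₁ (∼-trans xy yz)
      R-trans (inj₁ xy) (inj₂ (inj₁ (yi , jz))) = inj₂ (inj₁ (∼-trans xy yi , jz))
      R-trans (inj₁ xy) (inj₂ (inj₂ (yj , iz))) = inj₂ (inj₂ (∼-trans xy yj , iz))
      R-trans (inj₂ (inj₁ (xi , jy))) (inj₁ yz) = inj₂ (inj₁ (xi , ∼-trans jy yz))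
      R-trans (inj₂ (inj₂ (xj , iy))) (inj₁ yz) = inj₂ (inj₂ (xj , ∼-trans iy yz))
      R-trans (inj₂ (inj₁ (xi , _)))  (inj₂ (inj₁ (_ , jz))) = inj₂ (inj₁ (xi , jz))
      R-trans (inj₂ (inj₁ (xi , _)))  (inj₂ (inj₂ (_ , iz))) = inj₁ (∼-trans xi iz)
      R-trans (inj₂ (inj₂ (xj , _)))  (inj₂ (inj₁ (_ , jz))) = inj₁ (∼-trans xj jz)
      R-trans (inj₂ (inj₂ (xj , _)))  (inj₂ (inj₂ (_ , iz))) = inj₂ (inj₂ (xj , iz))

      R-equiv : IsEquivalence R
      R-equiv = record
        { refl  = inj₁ ∼-refl
        ; sym   = λ { (inj₁ xy) → inj₁ (∼-sym xy)
                    ; (inj₂ (inj₁ (xi , jy))) → inj₂ (inj₂ (∼-sym jy , ∼-sym xi))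
                    ; (inj₂ (inj₂ (xj , iy))) → inj₂ (inj₁ (∼-sym iy , ∼-sym xj)) }
        ; trans = R-trans
        }

      R-nc : ∀ {a b c d : Fin m} → a Fin.< b → b Fin.< c → c Fin.< d → R a c → R b d → R a b
      R-nc a<b b<c c<d (inj₁ ac) (inj₁ bd) = inj₁ (noncrossing a<b b<c c<d ac bd)
      R-nc a<b b<c c<d (inj₁ ac) (inj₂ (inj₁ (bi , jd)))
        with separated link ac a<b b<c bi jd (ℕ.<-asym c<d ∘ proj₂)
      ... | inj₁ ai = inj₁ (∼-trans ai (∼-sym bi))
      ... | inj₂ aj = inj₂ (inj₂ (aj , ∼-sym bi))
      R-nc a<b b<c c<d (inj₁ ac) (inj₂ (inj₂ (bj , id)))
        with separated link′ ac a<b b<c bj id (ℕ.<-asym c<d ∘ proj₂)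
      ... | inj₁ aj = inj₁ (∼-trans aj (∼-sym bj))
      ... | inj₂ ai = inj₂ (inj₁ (ai , ∼-sym bj))
      R-nc a<b b<c c<d (inj₂ (inj₁ (ai , jc))) (inj₁ bd)
        with separated link′ bd b<c c<d (∼-sym jc) (∼-sym ai) (ℕ.<-asym a<b ∘ proj₁)
      ... | inj₁ bj = inj₂ (inj₁ (ai , ∼-sym bj))
      ... | inj₂ bi = inj₁ (∼-trans ai (∼-sym bi))
      R-nc a<b b<c c<d (inj₂ (inj₂ (aj , ic))) (inj₁ bd)
        with separated link bd b<c c<d (∼-sym ic) (∼-sym aj) (ℕ.<-asym a<b ∘ proj₁)
      ... | inj₁ bi = inj₂ (inj₂ (aj , ∼-sym bi))
      ... | inj₂ bj = inj₁ (∼-trans aj (∼-sym bj))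
      R-nc a<b b<c c<d (inj₂ (inj₁ (ai , _))) (inj₂ (inj₁ (bi , _))) = inj₁ (∼-trans ai (∼-sym bi))
      R-nc a<b b<c c<d (inj₂ (inj₁ (ai , _))) (inj₂ (inj₂ (bj , _))) = inj₂ (inj₁ (ai , ∼-sym bj))
      R-nc a<b b<c c<d (inj₂ (inj₂ (aj , _))) (inj₂ (inj₁ (bi , _))) = inj₂ (inj₂ (aj , ∼-sym bi))
      R-nc a<b b<c c<d (inj₂ (inj₂ (aj , _))) (inj₂ (inj₂ (bj , _))) = inj₁ (∼-trans aj (∼-sym bj))

IsMin : NoncrossingPartition m → Pred (Fin m) _
IsMin π x = ∀ {y} → π ⊢ x ∼ y → x Fin.≤ y

isMin? : (π : NoncrossingPartition m) → U.Decidable (IsMin π)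
isMin? π x = map′ (λ f {y} → f y) (λ f y → f {y})
  (Fin.all? λ y → (π ⊢ x ∼? y) →-dec (x Fin.≤? y))

blockMin : (π : NoncrossingPartition m) (x : Fin m) → ∃ λ r → π ⊢ x ∼ r × IsMin π r
blockMin π x with ∃⇒∃least (π ⊢ x ∼?_) (x , ∼-refl)
... | r , x∼r , r≤ = r , x∼r , λ r∼y → r≤ _ (∼-trans x∼r r∼y)

-- A partition between σ and τ that relates i and j contains all of τ; one that does not contains no
-- pair beyond σ.
merge⇒⋖ : {σ τ : NoncrossingPartition m} {i j : Fin m} → Merge σ i j τ → ¬ σ ⊢ i ∼ j →
          FinitePoset._⋖_ (NC m) σ τ
merge⇒⋖ {σ = σ} {τ} {i} {j} σ→τ i≁j =
  (⊑⇒≼ {σ = σ} {τ} (extend σ→τ) , λ { refl → i≁j (joined σ→τ) }) , none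
  where
  none : ¬ ∃ λ ρ → (σ ≼ ρ × σ ≢ ρ) × (ρ ≼ τ × ρ ≢ τ)
  none (ρ , (σ≼ρ , σ≢ρ) , (ρ≼τ , ρ≢τ)) with ρ ⊢ i ∼? j
  ... | yes i∼j =
    ρ≢τ (⊑-antisym (≼⇒⊑ {σ = ρ} {τ} ρ≼τ) (merge-least σ→τ (≼⇒⊑ {σ = σ} {ρ} σ≼ρ) i∼j))
  ... | no i≁ρj = σ≢ρ (⊑-antisym incl λ xy → back xy (split σ→τ (≼⇒⊑ {σ = ρ} {τ} ρ≼τ xy)))
    where
    incl : σ ⊑ ρ
    incl = ≼⇒⊑ {σ = σ} {ρ} σ≼ρ
    back : ∀ {x y} → ρ ⊢ x ∼ y → Joined σ i j x y → σ ⊢ x ∼ y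
    back _  (inj₁ xy)               = xy
    back xy (inj₂ (inj₁ (xi , jy))) =
      contradiction (∼-trans (∼-sym (incl xi)) (∼-trans xy (∼-sym (incl jy)))) i≁ρj
    back xy (inj₂ (inj₂ (xj , iy))) =
      contradiction (∼-trans (incl iy) (∼-trans (∼-sym xy) (incl xj))) i≁ρj

≤⇒<⊎≡ : {x y : Fin m} → x Fin.≤ y → x Fin.< y ⊎ x ≡ y
≤⇒<⊎≡ {x = x} {y} x≤y with Fin.<-cmp x y
... | tri< x<y _ _ = inj₁ x<y
... | tri≈ _ x≡y _ = inj₂ x≡y
... | tri> _ _ y<x = contradiction x≤y (ℕ.<⇒≱ y<x)

-- A covering relation with both merged blocks named by their minima: `B₁` is the block of i and
-- `B₂` that of j.
record Cover (σ τ : NoncrossingPartition m) : Set where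
  field
    {i j}   : Fin m
    i<j     : i Fin.< j
    i-min   : IsMin σ i
    j-min   : IsMin σ j
    merging : Merge σ i j τ

  i≁j : ¬ σ ⊢ i ∼ j
  i≁j i∼j = ℕ.<⇒≱ i<j (j-min (∼-sym i∼j))

cover⇒⋖ : {σ τ : NoncrossingPartition m} → Cover σ τ → FinitePoset._⋖_ (NC m) σ τ
cover⇒⋖ C = merge⇒⋖ (Cover.merging C) (Cover.i≁j C)

min-unique : {π : NoncrossingPartition m} {x y : Fin m} → IsMin π x → IsMin π y → π ⊢ x ∼ y → x ≡ y
min-unique x-min y-min x∼y = Fin.≤-antisym (x-min x∼y) (y-min (∼-sym x∼y))

-- The step chosen from σ towards τ. Each block of τ is filled from left to right: by `lower`,
-- whatever precedes j in its τ-block is already in the σ-block of i. This prevents crossings and is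
-- what keeps the intermediate partition good.
record Mergeable (σ τ : NoncrossingPartition m) : Set where
  field
    {i j}   : Fin m
    i<j     : i Fin.< j
    i∼j     : τ ⊢ i ∼ j
    i-min   : IsMin τ i
    j-min   : IsMin σ j
    lower   : ∀ {x} → x Fin.< j → τ ⊢ x ∼ j → σ ⊢ x ∼ i

abstract
  -- j is the least element that is a block minimum of σ but not of τ.
  mergeable : {σ τ : NoncrossingPartition m} → σ ⊑ τ → σ ≢ τ → Mergeable σ τ
  mergeable {σ = σ} {τ} σ⊑τ σ≢τ with Fin.any? (λ j → isMin? σ j ×-dec ¬? (isMin? τ j))
  ... | no ∄j = contradiction (⊑-antisym σ⊑τ τ⊑σ) σ≢τ
    where
    -- If no minimum is lost, every block of τ contains just one minimum of σ, hence one block of σ.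
    min⁺ : ∀ {x} → IsMin σ x → IsMin τ x
    min⁺ {x} x-min = decidable-stable (isMin? τ x) λ ¬min → ∄j (x , (λ {y} → x-min {y}) , ¬min)

    τ⊑σ : τ ⊑ σ
    τ⊑σ {x} {y} x∼y with blockMin σ x | blockMin σ y
    ... | r , x∼r , r-min | s , y∼s , s-min with
      min-unique (min⁺ r-min) (min⁺ s-min) (∼-trans (∼-sym (σ⊑τ x∼r)) (∼-trans x∼y (σ⊑τ y∼s)))
    ...   | refl = ∼-trans x∼r (∼-sym y∼s)
  ... | yes ∃j with ∃⇒∃least (λ j → isMin? σ j ×-dec ¬? (isMin? τ j)) ∃j
  ...   | j , (j-min , ¬j-min) , j-least with blockMin τ j
  ...     | i , j∼i , i-min = record
    { i<j   = Fin.≤∧≢⇒< (i-min (∼-sym j∼i)) λ { refl → ¬j-min (λ {y} → i-min {y}) }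
    ; i∼j   = ∼-sym j∼i
    ; i-min = i-min
    ; j-min = j-min
    ; lower = lower
    }
    where
    lower : ∀ {x} → x Fin.< j → τ ⊢ x ∼ j → σ ⊢ x ∼ i
    lower {x} x<j x∼j with blockMin σ x
    ... | r , x∼r , r-min with isMin? τ r
    ...   | yes r-min′ = subst (σ ⊢ x ∼_) (min-unique r-min′ i-min
              (∼-trans (∼-sym (σ⊑τ x∼r)) (∼-trans x∼j j∼i))) x∼r
    ...   | no ¬r-min = contradiction (j-least r ((λ {y} → r-min {y}) , λ f → ¬r-min f))
              (ℕ.<⇒≱ (ℕ.≤-<-trans (r-min (∼-sym x∼r)) x<j))

module _ {σ τ : NoncrossingPartition m} (σ⊑τ : σ ⊑ τ) (M : Mergeable σ τ) where
  open Mergeable M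

  mergeable-linked : Linked σ i j
  mergeable-linked {p} {q} p∼q p<i i<q with Fin.<-cmp q j
  ... | tri< q<j _ _  =
    contradiction (i-min (∼-sym (noncrossing p<i i<q q<j (σ⊑τ p∼q) i∼j))) (ℕ.<⇒≱ p<i)
  ... | tri≈ _ refl _ = inj₂ (inj₁ p∼q)
  ... | tri> _ _ j<q  = inj₂ (inj₂ (ℕ.<-trans p<i i<j , j<q))

  mergeable-linked′ : Linked σ j i
  mergeable-linked′ {p} {q} p∼q p<j j<q with Fin.<-cmp p i
  ... | tri< p<i _ _  = inj₂ (inj₂ (p<i , ℕ.<-trans i<j j<q))
  ... | tri≈ _ refl _ = inj₂ (inj₁ ∼-refl)
  ... | tri> _ _ i<p  =
    inj₂ (inj₁ (lower p<j (∼-trans (∼-sym (noncrossing i<p p<j j<q i∼j (σ⊑τ p∼q))) i∼j)))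

  abstract
    cover : ∃ λ ρ → Merge σ i j ρ
    cover = merge mergeable-linked mergeable-linked′

-- The order of Poset(PF_{n,k})

module PFOrder {n : ℕ} (a b : Fin (suc n)) (a⋖b : suc (toℕ a) ≡ toℕ b) (0<a : 0 < toℕ a) where

  private
    Partition : Set
    Partition = NoncrossingPartition (suc n)

    variable
      π σ τ : Partition

  a<b : a Fin.< b
  a<b = ℕ.≤-reflexive a⋖b

  -- a and b stand for the numbers k and k + 1, and _↝_ for the order of
  -- Poset(PF_{n,k}): since k is not a label, the block of k can only join that
  -- of k + 1 from inside, where some smaller β in the latter wraps around it.
  -- Every label above k occurs, which makes the blocks convex from k + 1 on.
  Convex : Partition → Set
  Convex π = ∀ {x y z} → b Fin.≤ y → x Fin.< y → y Fin.< z → π ⊢ x ∼ z → π ⊢ y ∼ z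

  Below : Fin (suc n) → Partition → Set
  Below β π = ∀ {x} → π ⊢ x ∼ a → β Fin.< x

  -- `wraps` is what `_↝_` demands from the discrete partition to π, and `nested` what it demands
  -- from π to the indiscrete one.
  record Good (π : Partition) : Set where
    field
      convex : Convex π
      wraps  : π ⊢ a ∼ b → ∃ λ β → π ⊢ β ∼ a × β Fin.< a
      nested : ¬ π ⊢ a ∼ b → ∃ λ β → Below β π

  open Good

  infix 4 _↝_ _⇝_

  record _↝_ (σ τ : Partition) : Set where
    field
      incl : σ ⊑ τ
      wrap : ¬ σ ⊢ a ∼ b → τ ⊢ a ∼ b → ∃ λ β → τ ⊢ β ∼ a × Below β σ

  -- A variant of _↝_ where β already lies in the block of b, so that the
  -- minimal admissible merging towards τ never leaves this relation.
  record _⇝_ (σ τ : Partition) : Set where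
    field
      incl : σ ⊑ τ
      wrap : ¬ σ ⊢ a ∼ b → τ ⊢ a ∼ b → ∃ λ β → σ ⊢ β ∼ b × Below β σ

  ⇝⇒↝ : σ ⇝ τ → σ ↝ τ
  ⇝⇒↝ σ⇝τ = record
    { incl = incl
    ; wrap = λ a≁b a∼b → let β , β∼b , β< = wrap a≁b a∼b in
               β , ∼-trans (incl β∼b) (∼-sym a∼b) , λ {x} → β< {x}
    }
    where open _⇝_ σ⇝τ

  ↝-refl : π ↝ π
  ↝-refl = record { incl = id ; wrap = λ a≁b a∼b → contradiction a∼b a≁b }

  ↝-trans : ∀ {ρ} → σ ↝ ρ → ρ ↝ τ → σ ↝ τ
  ↝-trans {σ} {τ} {ρ} σ↝ρ ρ↝τ = record { incl = R.incl ∘ S.incl ; wrap = wrap }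
    where
    module S = _↝_ σ↝ρ
    module R = _↝_ ρ↝τ
    wrap : ¬ σ ⊢ a ∼ b → τ ⊢ a ∼ b → ∃ λ β → τ ⊢ β ∼ a × Below β σ
    wrap σ≁ τ∼ with ρ ⊢ a ∼? b
    ... | yes ρ∼ = let β , β∼a , β< = S.wrap σ≁ ρ∼ in β , R.incl β∼a , λ {x} → β< {x}
    ... | no  ρ≁ = let β , β∼a , β< = R.wrap ρ≁ τ∼ in β , β∼a , λ x∼a → β< (S.incl x∼a)

  record PFStep (σ τ : Partition) : Set where
    field
      covers : Cover σ τ
      step   : σ ↝ τ
      good₁  : Good σ
      good₂  : Good τ

  pfStep : Good σ → Good τ → σ ⇝ τ → σ ≢ τ → ∃ λ ρ → PFStep σ ρ × ρ ⇝ τ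
  pfStep {σ} {τ} σ-good τ-good σ⇝τ σ≢τ = ρ , record
    { covers = record { i<j = i<j ; i-min = i-min ∘ incl ; j-min = j-min ; merging = σ→ρ }
    ; step   = record { incl = extend σ→ρ ; wrap = λ σ≁ ρ∼ →
        let β , β∼b , β< = wrap σ≁ (ρ⊑τ ρ∼) in
        β , ∼-trans (extend σ→ρ β∼b) (∼-sym ρ∼) , λ {x} → β< {x} }
    ; good₁  = σ-good
    ; good₂  = record { convex = ρ-convex ; wraps = ρ-wraps ; nested = ρ-nested }
    } , record { incl = ρ⊑τ ; wrap = ρ-wrap }
    where
    open _⇝_ σ⇝τ
    M = mergeable incl σ≢τ
    open Mergeable M
    ρ : Partition
    ρ = proj₁ (cover incl M)
    σ→ρ : Merge σ i j ρ
    σ→ρ = proj₂ (cover incl M)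

    ρ⊑τ : ρ ⊑ τ
    ρ⊑τ = merge-least σ→ρ incl i∼j

    ρ-convex : Convex ρ
    ρ-convex {x} {y} {z} b≤y x<y y<z x∼z with split σ→ρ x∼z
    ... | inj₁ xz = extend σ→ρ (convex σ-good b≤y x<y y<z xz)
    ... | inj₂ (inj₂ (xj , iz)) =
      extend σ→ρ (convex σ-good b≤y (ℕ.<-trans i<j (ℕ.≤-<-trans (j-min (∼-sym xj)) x<y)) y<z iz)
    ... | inj₂ (inj₁ (xi , jz)) with Fin.<-cmp y j
    ...   | tri> _ _ j<y  = extend σ→ρ (convex σ-good b≤y j<y y<z jz)
    ...   | tri≈ _ refl _ = extend σ→ρ jz
    -- Convexity of τ puts y into the τ-block of j; as y precedes j, `lower` places it in the block
    -- of i.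
    ...   | tri< y<j _ _  =
      ∼-trans (extend σ→ρ (lower y<j y∼j)) (∼-trans (joined σ→ρ) (extend σ→ρ jz))
      where
      y∼j : τ ⊢ y ∼ j
      y∼j = ∼-trans (convex τ-good b≤y x<y y<z (ρ⊑τ x∼z)) (∼-sym (incl jz))

    ρ-wraps : ρ ⊢ a ∼ b → ∃ λ β → ρ ⊢ β ∼ a × β Fin.< a
    ρ-wraps ρ∼ with σ ⊢ a ∼? b
    ... | yes σ∼ = let β , β∼a , β<a = wraps σ-good σ∼ in β , extend σ→ρ β∼a , β<a
    ... | no  σ≁ = let β , β∼b , β<  = wrap σ≁ (ρ⊑τ ρ∼) in
                   β , ∼-trans (extend σ→ρ β∼b) (∼-sym ρ∼) , β< ∼-refl

    ρ-wrap : ¬ ρ ⊢ a ∼ b → τ ⊢ a ∼ b → ∃ λ β → ρ ⊢ β ∼ b × Below β ρ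
    ρ-wrap ρ≁ τ∼ with wrap (ρ≁ ∘ extend σ→ρ) τ∼
    ... | β , β∼b , β< = β , extend σ→ρ β∼b , β<′
      where
      τ-β∼a : τ ⊢ β ∼ a
      τ-β∼a = ∼-trans (incl β∼b) (∼-sym τ∼)
      β<′ : Below β ρ
      β<′ {x} x∼a with split σ→ρ x∼a
      ... | inj₁ xa               = β< xa
      ... | inj₂ (inj₂ (xj , ia)) =
        contradiction (i-min (∼-trans (incl ia) (∼-sym τ-β∼a))) (ℕ.<⇒≱ (β< ia))
      -- β precedes j in its τ-block, so `lower` puts β, and with it b, into the block of i; the
      -- merge would then join a to b. Here it matters that β is already in the block of b.
      ... | inj₂ (inj₁ (xi , ja)) = contradiction a∼b ρ≁
        where
        a∼b : ρ ⊢ a ∼ b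
        a∼b = ∼-trans (extend σ→ρ (∼-sym ja)) (∼-trans (∼-sym (joined σ→ρ)) (extend σ→ρ
          (∼-trans (∼-sym (lower (β< ja) (∼-trans τ-β∼a (∼-sym (incl ja))))) β∼b)))

    ρ-nested : ¬ ρ ⊢ a ∼ b → ∃ λ β → Below β ρ
    ρ-nested ρ≁ with τ ⊢ a ∼? b
    ... | yes τ∼ = let β , _ , β< = ρ-wrap ρ≁ τ∼ in β , λ {x} → β< {x}
    ... | no  τ≁ = let β , β< = nested τ-good τ≁ in β , λ x∼a → β< (ρ⊑τ x∼a)

  private
    module NC = FinitePoset (NC (suc n))

  ⇝⇒star : Good σ → Good τ → σ ⇝ τ → Star PFStep σ τ
  ⇝⇒star {σ} {τ} = go σ (NC.<-noetherian σ)
    where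
    go : ∀ σ → Acc (flip NC._<_) σ → Good σ → Good τ → σ ⇝ τ → Star PFStep σ τ
    go σ (acc rec) σ-good τ-good σ⇝τ with σ NC.≟ τ
    ... | yes refl = ε
    ... | no σ≢τ = let ρ , s , ρ⇝τ = pfStep σ-good τ-good σ⇝τ σ≢τ in
      s ◅ go ρ (rec (proj₁ (cover⇒⋖ (PFStep.covers s)))) (PFStep.good₂ s) τ-good ρ⇝τ

  -- ρ is the join of σ with the atom whose only nontrivial block is {β, b}.
  record Wrapping (σ τ : Partition) : Set where
    field
      {β}     : Fin (suc n)
      {ρ}     : Partition
      β-min   : IsMin τ β
      β∼a     : τ ⊢ β ∼ a
      merging : Merge σ β b ρ
      ρ≁      : ¬ ρ ⊢ a ∼ b
      ρ-good  : Good ρ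
      σ⇝ρ     : σ ⇝ ρ
      ρ⇝τ     : ρ ⇝ τ

  -- The construction serves twice: it splits `_↝_` into two `_⇝_`, from which chains are built, and
  -- its ρ is the closure of σ below τ in the Möbius argument.
  wrapping : Good σ → σ ↝ τ → ¬ σ ⊢ a ∼ b → τ ⊢ a ∼ b → Wrapping σ τ
  wrapping {σ} {τ} σ-good σ↝τ σ≁ τ∼ with blockMin τ a
  ... | β , a∼β , β-min = record
    { β-min = β-min ; β∼a = ∼-sym a∼β ; merging = σ→ρ ; ρ≁ = ρ≁
    ; ρ-good = record
      { convex = ρ-convex ; wraps = λ ρ∼ → contradiction ρ∼ ρ≁ ; nested = λ _ → β , below }
    ; σ⇝ρ = record { incl = extend σ→ρ ; wrap = λ _ ρ∼ → contradiction ρ∼ ρ≁ }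
    ; ρ⇝τ = record { incl = ρ⊑τ ; wrap = λ _ _ → β , joined σ→ρ , below }
    }
    where
    open _↝_ σ↝τ
    β<σ : Below β σ
    -- The witness of `wrap` lies in the τ-block of a, so the minimum β of that block is no larger
    -- and is below the σ-block of a as well.
    β<σ x∼a = let β′ , β′∼a , β′< = wrap σ≁ τ∼ in
      ℕ.≤-<-trans (β-min (∼-trans (∼-sym a∼β) (∼-sym β′∼a))) (β′< x∼a)

    β<b : β Fin.< b
    β<b = ℕ.<-trans (β<σ ∼-refl) a<b

    β∼b : τ ⊢ β ∼ b
    β∼b = ∼-trans (∼-sym a∼β) τ∼

    linked : Linked σ β b
    linked {p} {q} p∼q p<β β<q with Fin.<-cmp q b
    ... | tri< q<b _ _  =
      contradiction (β-min (∼-sym (noncrossing p<β β<q q<b (incl p∼q) β∼b))) (ℕ.<⇒≱ p<β)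
    ... | tri≈ _ refl _ = inj₂ (inj₁ p∼q)
    ... | tri> _ _ b<q  = inj₂ (inj₂ (ℕ.<-trans p<β β<b , b<q))

    linked′ : Linked σ b β
    -- By convexity a chord around b can only belong to the block of b.
    linked′ p∼q p<b b<q = inj₁ (∼-trans p∼q (∼-sym (convex σ-good ℕ.≤-refl p<b b<q p∼q)))

    ρ : Partition
    ρ = proj₁ (merge linked linked′)
    σ→ρ : Merge σ β b ρ
    σ→ρ = proj₂ (merge linked linked′)

    block-a : ∀ {x} → ρ ⊢ x ∼ a → σ ⊢ x ∼ a
    block-a x∼a with split σ→ρ x∼a
    ... | inj₁ xa              = xa
    ... | inj₂ (inj₁ (_ , ba)) = contradiction (∼-sym ba) σ≁
    ... | inj₂ (inj₂ (_ , βa)) = contradiction (β<σ βa) (ℕ.<-irrefl refl)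

    below : Below β ρ
    below x∼a = β<σ (block-a x∼a)

    ρ≁ : ¬ ρ ⊢ a ∼ b
    ρ≁ ρ∼ = σ≁ (∼-sym (block-a (∼-sym ρ∼)))

    ρ⊑τ : ρ ⊑ τ
    ρ⊑τ = merge-least σ→ρ incl β∼b

    ρ-convex : Convex ρ
    ρ-convex {x} {y} {z} b≤y x<y y<z x∼z with split σ→ρ x∼z
    ... | inj₁ xz = extend σ→ρ (convex σ-good b≤y x<y y<z xz)
    ... | inj₂ (inj₂ (_ , βz)) = extend σ→ρ (convex σ-good b≤y (ℕ.<-≤-trans β<b b≤y) y<z βz)
    ... | inj₂ (inj₁ (_ , bz)) with ≤⇒<⊎≡ b≤y
    ...   | inj₁ b<y  = extend σ→ρ (convex σ-good b≤y b<y y<z bz)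
    ...   | inj₂ refl = extend σ→ρ bz

  ↝⇒star : Good σ → Good τ → σ ↝ τ → Star PFStep σ τ
  ↝⇒star {σ} {τ} σ-good τ-good σ↝τ with σ ⊢ a ∼? b | τ ⊢ a ∼? b
  ... | yes σ∼ | _      = ⇝⇒star σ-good τ-good
    record { incl = _↝_.incl σ↝τ ; wrap = λ σ≁ _ → contradiction σ∼ σ≁ }
  ... | no _   | no τ≁  = ⇝⇒star σ-good τ-good
    record { incl = _↝_.incl σ↝τ ; wrap = λ _ τ∼ → contradiction τ∼ τ≁ }
  ... | no σ≁  | yes τ∼ = ⇝⇒star σ-good ρ-good σ⇝ρ ◅◅ ⇝⇒star ρ-good τ-good ρ⇝τ
    where open Wrapping (wrapping σ-good σ↝τ σ≁ τ∼)

  discrete : Partition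
  discrete = fromEquivalence {R = _≡_} Fin._≟_ isEquivalence
    λ { a<b b<c _ refl _ → contradiction (ℕ.<-trans a<b b<c) (ℕ.<-irrefl refl) }

  discrete⁻ : ∀ {x y} → discrete ⊢ x ∼ y → x ≡ y
  discrete⁻ = fromEquivalence⁻ {R = _≡_} Fin._≟_ isEquivalence _

  discrete-⊑ : discrete ⊑ π
  discrete-⊑ x∼y with refl ← discrete⁻ x∼y = ∼-refl

  indiscrete : Partition
  indiscrete = fromEquivalence {R = λ _ _ → ⊤} (λ _ _ → yes tt) _ _

  indiscrete⁺ : ∀ {x y} → indiscrete ⊢ x ∼ y
  indiscrete⁺ = fromEquivalence⁺ {R = λ _ _ → ⊤} (λ _ _ → yes tt) _ _ tt

  discrete-good : Good discrete
  discrete-good = record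
    { convex = λ _ x<y y<z x∼z →
        contradiction (ℕ.<-trans x<y y<z) (ℕ.<-irrefl (cong toℕ (discrete⁻ x∼z)))
    ; wraps  = λ a∼b → contradiction a<b (ℕ.<-irrefl (cong toℕ (discrete⁻ a∼b)))
    -- This uses k > 1: the number 1 is smaller than k.
    ; nested = λ _ → zero , λ x∼a → subst (zero {n} Fin.<_) (sym (discrete⁻ x∼a)) 0<a
    }

  indiscrete-good : Good indiscrete
  indiscrete-good = record
    { convex = λ _ _ _ _ → indiscrete⁺
    ; wraps  = λ _ → zero , indiscrete⁺ , 0<a
    ; nested = λ a≁b → contradiction indiscrete⁺ a≁b
    }

  discrete-↝ : Good π → discrete ↝ π
  discrete-↝ π-good = record
    { incl = discrete-⊑
    ; wrap = λ _ a∼b → let β , β∼a , β<a = wraps π-good a∼b in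
               β , β∼a , λ x∼a → subst (β Fin.<_) (sym (discrete⁻ x∼a)) β<a
    }

  ↝-indiscrete : Good π → π ↝ indiscrete
  ↝-indiscrete π-good = record
    { incl = λ _ → indiscrete⁺
    ; wrap = λ a≁b _ → let β , β< = nested π-good a≁b in β , indiscrete⁺ , λ {x} → β< {x}
    }

-- Chains and their labels

steps-mono : ∀ {a r} {A : Set a} {R : Rel A r} → Reflexive R → Transitive R →
             ∀ {l} (f : Fin (suc l) → A) → (∀ i → R (f (inject₁ i)) (f (suc i))) →
             ∀ {i j} → i Fin.≤ j → R (f i) (f j)
steps-mono R-refl R-trans f step {zero}  {zero}  _ = R-refl
steps-mono {R = R} R-refl R-trans {suc l} f step {zero}  {suc j} _ =
  R-trans (step zero) (steps-mono {R = R} R-refl R-trans (f ∘ suc) (step ∘ suc) {zero} {j} z≤n)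
steps-mono {R = R} R-refl R-trans {suc l} f step {suc i} {suc j} (s≤s i≤j) =
  steps-mono {R = R} R-refl R-trans (f ∘ suc) (step ∘ suc) i≤j

∃-switch : ∀ {p l} {P : Pred (Fin (suc l)) p} → U.Decidable P → P zero → ¬ P (fromℕ l) →
           ∃ λ i → P (inject₁ i) × ¬ P (suc i)
∃-switch {l = zero}  P? P0 ¬Pl = contradiction P0 ¬Pl
∃-switch {l = suc l} P? P0 ¬Pl with P? (suc zero)
... | no ¬P1 = zero , P0 , ¬P1
... | yes P1 = let i , Pi , ¬Pi = ∃-switch (P? ∘ suc) P1 ¬Pl in suc i , Pi , ¬Pi

inject₁<suc : ∀ {l} {i : Fin l} {j : Fin (suc l)} → ¬ j Fin.≤ inject₁ i → suc i Fin.≤ j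
inject₁<suc {i = i} j≰i = subst (ℕ._< _) (Fin.toℕ-inject₁ i) (ℕ.≰⇒> j≰i)

∈⇒∃lookup : ∀ {a} {A : Set a} {l x} {xs : Vec A l} → x ∈ᵥ xs → ∃ λ i → x ≡ lookup xs i
∈⇒∃lookup x∈ = Any.index x∈ , lookup-index x∈

-- Since j is the least element of `B₂`, being less than every element of `B₂` is being less than j.
record IsLabel {σ τ : NoncrossingPartition m} (C : Cover σ τ) (l : Fin m) : Set where
  open Cover C
  field
    i∼l      : σ ⊢ i ∼ l
    l<j      : l Fin.< j
    greatest : ∀ {x} → σ ⊢ i ∼ x → x Fin.< j → x Fin.≤ l

module _ {σ τ : NoncrossingPartition m} (C : Cover σ τ) where
  open Cover C

  i-min-τ : IsMin τ i
  i-min-τ i∼x with split merging i∼x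
  ... | inj₁ ix              = i-min ix
  ... | inj₂ (inj₁ (_ , jx)) = ℕ.≤-trans (ℕ.<⇒≤ i<j) (j-min jx)
  ... | inj₂ (inj₂ (ij , _)) = contradiction ij i≁j

  j-not-min : ¬ IsMin τ j
  j-not-min j-min′ = ℕ.<⇒≱ i<j (j-min′ (∼-sym (joined merging)))

  -- With `j-not-min`, this makes j the one block minimum that the cover destroys. Counting
  -- destroyed minima later gives the length of chains.
  lost-min : ∀ {x} → IsMin σ x → ¬ IsMin τ x → x ≡ j
  lost-min {x} x-min ¬x-min with blockMin τ x
  ... | r , x∼r , r-min with split merging x∼r
  ...   | inj₁ xr with refl ← Fin.≤-antisym (x-min xr) (r-min (∼-sym x∼r)) =
    contradiction (λ {y} → r-min {y}) ¬x-min
  ...   | inj₂ (inj₂ (xj , _)) = min-unique x-min j-min xj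
  ...   | inj₂ (inj₁ (xi , jr)) with refl ← min-unique x-min i-min xi =
    contradiction (ℕ.<-≤-trans i<j (j-min jr)) (ℕ.≤⇒≯ (r-min (∼-sym x∼r)))

  ∃label : ∃ (IsLabel C)
  ∃label =
    let l , (il , l<j) , l-max =
          ∃⇒∃greatest (λ l → (σ ⊢ i ∼? l) ×-dec (l Fin.<? j)) (i , ∼-refl , i<j) in
    l , record { i∼l = il ; l<j = l<j ; greatest = λ ix x<j → l-max _ (ix , x<j) }

  isLabel⇒label : ∀ {l} → IsLabel C l → Label σ τ l
  isLabel⇒label {l} L = block σ i , block σ j ,
    (λ eq → i≁j (same (subst (j ∈_) (sym eq) (member (∼-refl {π = σ}))))) ,
    (i , refl) , (j , refl) ,
    (i , ⊆-antisym (λ x∈ → to (split merging (same x∈)))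
                   (λ x∈ → from (x∈p∪q⁻ (block σ i) (block σ j) x∈))) ,
    (i , (x∈p∪q⁺ (inj₁ (member (∼-refl {π = σ}))) ,
          λ x x∈ → least (x∈p∪q⁻ (block σ i) (block σ j) x∈)) ,
     member (∼-refl {π = σ})) ,
    ((member i∼l , λ x x∈ → ℕ.<-≤-trans l<j (j-min (same x∈))) ,
     λ x (x∈ , x<) → greatest (same x∈) (x< j (member (∼-refl {π = σ}))))
    where
    open IsLabel L
    to : ∀ {x} → Joined σ i j i x → x ∈ block σ i ∪ block σ j
    to (inj₁ ix) = x∈p∪q⁺ (inj₁ (member ix))
    to (inj₂ (inj₁ (_ , jx))) = x∈p∪q⁺ (inj₂ (member jx))
    to (inj₂ (inj₂ (ij , _))) = contradiction ij i≁j
    from : ∀ {x} → x ∈ block σ i ⊎ x ∈ block σ j → x ∈ block τ i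
    from (inj₁ x∈) = member (extend merging (same x∈))
    from (inj₂ x∈) = member (∼-trans (joined merging) (extend merging (same x∈)))
    least : ∀ {x} → x ∈ block σ i ⊎ x ∈ block σ j → i Fin.≤ x
    least (inj₁ x∈) = i-min (same x∈)
    least (inj₂ x∈) = ℕ.≤-trans (ℕ.<⇒≤ i<j) (j-min (same x∈))

-- The two blocks fill a block of τ, so merging them in σ crosses nothing. The result is strictly
-- above σ and below τ, and the covering relation leaves only τ itself.
merge-of-block : {σ τ : NoncrossingPartition m} → FinitePoset._⋖_ (NC m) σ τ → ∀ {i j} →
  ¬ σ ⊢ i ∼ j → τ ⊢ i ∼ j → (∀ {x} → τ ⊢ i ∼ x → σ ⊢ x ∼ i ⊎ σ ⊢ x ∼ j) → Merge σ i j τ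
merge-of-block {m = m} {σ} {τ} ((σ≼τ , _) , none) {i} {j} i≁j i∼j halves =
  conclude (merge linked linked′)
  where
  module NC = FinitePoset (NC m)
  incl : σ ⊑ τ
  incl = ≼⇒⊑ {σ = σ} {τ} σ≼τ

  linked : Linked σ i j
  linked p∼q p<i i<q with ∼-cross (incl p∼q) p<i i<q i∼j
  ... | inj₁ p∼i   = Sum.map₂ inj₁ (halves (∼-sym p∼i))
  ... | inj₂ p<j<q = inj₂ (inj₂ p<j<q)

  linked′ : Linked σ j i
  linked′ p∼q p<j j<q with ∼-cross (incl p∼q) p<j j<q (∼-sym i∼j)
  ... | inj₁ p∼j   = Sum.map₂ inj₁ (Sum.swap (halves (∼-trans i∼j (∼-sym p∼j))))
  ... | inj₂ p<i<q = inj₂ (inj₂ p<i<q)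

  conclude : ∃ (Merge σ i j) → Merge σ i j τ
  conclude (ρ , σ→ρ) with ρ NC.≟ τ
  ... | yes refl = σ→ρ
  ... | no  ρ≢τ  = contradiction
    (ρ , (⊑⇒≼ {σ = σ} {ρ} (extend σ→ρ) , λ { refl → i≁j (joined σ→ρ) })
       , (⊑⇒≼ {σ = ρ} {τ} (merge-least σ→ρ incl i∼j) , ρ≢τ))
    none

label⇒isLabel : {σ τ : NoncrossingPartition m} {l : Fin m} →
                FinitePoset._⋖_ (NC m) σ τ → Label σ τ l →
                ∃ λ (C : Cover σ τ) → IsLabel C l
label⇒isLabel {σ = σ} {τ} {l} σ⋖τ
  (_ , _ , B₁≢B₂ , (p , refl) , (q , refl) , (r , r≡) , (i , (_ , i-least) , i∈B₁) ,
   (l∈B₁ , l<B₂) , l-max)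
  with blockMin σ q
... | j , q∼j , j-min =
    record { i<j = i<j ; i-min = i-min ; j-min = j-min
           ; merging = merge-of-block σ⋖τ i≁j
               (∼-trans (∼-sym (r∼ (inj₁ p∼i))) (r∼ (inj₂ q∼j))) halves }
    , record { i∼l = ∼-trans (∼-sym p∼i) (same l∈B₁) ; l<j = l<B₂ j (member q∼j)
             ; greatest = λ ix x<j → l-max _ (member (∼-trans p∼i ix) , λ y y∈ →
                 ℕ.<-≤-trans x<j (j-min (∼-trans (∼-sym q∼j) (same y∈)))) }
  where
  p∼i : σ ⊢ p ∼ i
  p∼i = same i∈B₁

  i≁j : ¬ σ ⊢ i ∼ j
  i≁j ij = B₁≢B₂ (trans (sym (block-≡ p∼i)) (trans (sym (block-≡ ij)) (block-≡ q∼j)))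

  i-min : IsMin σ i
  i-min ix = i-least _ (x∈p∪q⁺ (inj₁ (member (∼-trans p∼i ix))))

  i<j : i Fin.< j
  i<j = Fin.≤∧≢⇒< (i-least j (x∈p∪q⁺ (inj₂ (member q∼j)))) λ { refl → i≁j ∼-refl }

  r∼ : ∀ {x} → σ ⊢ p ∼ x ⊎ σ ⊢ q ∼ x → τ ⊢ r ∼ x
  r∼ {x} = same ∘ subst (x ∈_) (sym r≡) ∘ x∈p∪q⁺ ∘ Sum.map member member

  halves : ∀ {x} → τ ⊢ i ∼ x → σ ⊢ x ∼ i ⊎ σ ⊢ x ∼ j
  halves {x} ix = Sum.map
    (λ x∈ → ∼-trans (∼-sym (same x∈)) p∼i) (λ x∈ → ∼-trans (∼-sym (same x∈)) q∼j)
    (x∈p∪q⁻ _ _ (subst (x ∈_) r≡ (member (∼-trans (r∼ (inj₁ p∼i)) ix))))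

-- Identification of Poset(PF_{n,k}) with the good partitions under `_↝_`

module PFChains {n k : ℕ} (a b : Fin (suc n)) (a⋖b : suc (toℕ a) ≡ toℕ b) (0<a : 0 < toℕ a)
                (b≡k : toℕ b ≡ k) where
  open PFOrder a b a⋖b 0<a
  open Good

  private
    Partition : Set
    Partition = NoncrossingPartition (suc n)

    number : Fin (suc n) → ℕ
    number = suc ∘ toℕ

  module FromChain (c : Chain n k) (pf : IsPFChain n k c) where
    private
      v : Fin (suc n) → Partition
      v = lookup c

      ls : Vec (Fin (suc n)) n
      ls = proj₁ (proj₂ pf)

      l : Fin n → Fin (suc n)
      l = lookup ls

      numbers : Vec ℕ n
      numbers = Vec.map number ls

      k∉ : ¬ k ∈ᵥ numbers
      k∉ = proj₁ (proj₂ (proj₂ (proj₂ (proj₂ pf))))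

      >k∈ : ∀ j → k < j → j ≤ n → j ∈ᵥ numbers
      >k∈ = proj₂ (proj₂ (proj₂ (proj₂ (proj₂ pf))))

      labelled : ∀ i → ∃ λ (C : Cover (v (inject₁ i)) (v (suc i))) → IsLabel C (l i)
      labelled i = label⇒isLabel (proj₂ (proj₂ (proj₁ pf)) i) (proj₁ (proj₂ (proj₂ pf)) i)

      mono : ∀ {i j} → i Fin.≤ j → v i ⊑ v j
      mono = steps-mono {R = _⊑_} (λ xy → xy) (λ s t xy → t (s xy)) v
        (λ i → extend (Cover.merging (proj₁ (labelled i))))

      l≢a : ∀ i → l i ≢ a
      l≢a i li≡a = k∉ (subst (_∈ᵥ numbers)
        (trans (lookup-map i number ls) (trans (cong number li≡a) (trans a⋖b b≡k)))
        (∈-lookup i numbers))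

      ∃l : ∀ {y z} → b Fin.≤ y → y Fin.< z → ∃ λ i → l i ≡ y
      ∃l {y} {z} b≤y y<z with ∈⇒∃lookup (>k∈ (number y) (s≤s (subst (ℕ._≤ toℕ y) b≡k b≤y))
                                            (ℕ.≤-trans y<z (ℕ.s≤s⁻¹ (Fin.toℕ<n z))))
      ... | i , eq =
        i , Fin.toℕ-injective (ℕ.suc-injective (sym (trans eq (lookup-map i number ls))))

      -- The label y, and by induction each label above it, occurs; so y is
      -- joined to its successor while that successor is still a block minimum.
      convex-at : ∀ y → Acc Fin._>_ y → b Fin.≤ y → ∀ {x z} → x Fin.< y → y Fin.< z →
                  ∀ t → v t ⊢ x ∼ z → v t ⊢ y ∼ z
      convex-at y (acc rec) b≤y {x} {z} x<y y<z t x∼z with ∃l b≤y y<z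
      ... | s , refl = y∼z (t Fin.≤? inject₁ s)
        where
        open Cover (proj₁ (labelled s))
        open IsLabel (proj₂ (labelled s))

        IH : ∀ {w x z} → y Fin.< w → x Fin.< w → w Fin.< z → ∀ t → v t ⊢ x ∼ z → v t ⊢ w ∼ z
        IH y<w = convex-at _ (rec y<w) (ℕ.≤-trans b≤y (ℕ.<⇒≤ y<w))

        y∼j : v (suc s) ⊢ y ∼ j
        y∼j = ∼-trans (∼-sym (extend merging i∼l)) (joined merging)

        -- So j is the successor of y: by induction an element w strictly between would be joined to
        -- j, hence lie in the block of i below j, and the label would be at least w.
        j≤ : ∀ {w} → y Fin.< w → j Fin.≤ w
        j≤ {w} y<w = ℕ.≮⇒≥ λ w<j → impossible w<j (split merging
          (∼-trans (joined merging) (∼-sym (IH y<w y<w w<j (suc s) y∼j))))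
          where
          impossible : w Fin.< j → ¬ Joined (v (inject₁ s)) i j i w
          impossible w<j (inj₁ iw)              = ℕ.<⇒≱ y<w (greatest iw w<j)
          impossible w<j (inj₂ (inj₁ (_ , jw))) = ℕ.<⇒≱ w<j (j-min jw)
          impossible w<j (inj₂ (inj₂ (ij , _))) = i≁j ij

        j∼z : v t ⊢ j ∼ z
        j∼z with ≤⇒<⊎≡ (j≤ y<z)
        ... | inj₁ j<z  = IH l<j (ℕ.<-trans x<y l<j) j<z t x∼z
        ... | inj₂ refl = ∼-refl

        y∼z : Dec (t Fin.≤ inject₁ s) → v t ⊢ y ∼ z
        y∼z (no t≰s)  = ∼-trans (mono (inject₁<suc t≰s) y∼j) j∼z
        y∼z (yes t≤s) = contradiction (j-min (∼-sym (mono t≤s (∼-trans x∼z (∼-sym j∼z)))))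
          (ℕ.<⇒≱ (ℕ.<-trans x<y l<j))

    step-↝ : ∀ s → v (inject₁ s) ↝ v (suc s)
    step-↝ s = record { incl = extend merging ; wrap = λ σ≁ τ∼ → wrap σ≁ (split merging τ∼) }
      where
      open Cover (proj₁ (labelled s))
      open IsLabel (proj₂ (labelled s))
      σ = v (inject₁ s)

      wrap : ¬ σ ⊢ a ∼ b → Joined σ i j a b → ∃ λ β → v (suc s) ⊢ β ∼ a × Below β σ
      wrap σ≁ (inj₁ ab) = contradiction ab σ≁
      wrap σ≁ (inj₂ (inj₂ (aj , ib))) =
        i , ∼-trans (joined merging) (extend merging (∼-sym aj)) ,
        λ x∼a → ℕ.<-≤-trans i<j (j-min (∼-sym (∼-trans x∼a aj)))
      -- With a in the block of i and b in that of j, j < a gives a crossing, while j > a forces j =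
      -- b and makes a the label.
      wrap σ≁ (inj₂ (inj₁ (ai , jb))) with Fin.<-cmp j a
      ... | tri≈ _ refl _ = contradiction (∼-sym ai) i≁j
      ... | tri< j<a _ _  = contradiction (noncrossing i<j j<a a<b (∼-sym ai) jb) i≁j
      ... | tri> _ _ a<j  = contradiction
        (Fin.≤-antisym (ℕ.s≤s⁻¹ (ℕ.≤-trans l<j (ℕ.≤-trans (j-min jb) (ℕ.≤-reflexive (sym a⋖b)))))
                       (greatest (∼-sym ai) a<j))
        (l≢a s)

    ↝-at : ∀ {i j} → i Fin.≤ j → v i ↝ v j
    ↝-at = steps-mono {R = _↝_} ↝-refl ↝-trans v step-↝

    good-at : ∀ t → Good (v t)
    good-at t = record
      { convex = λ {x} {y} b≤y x<y y<z → convex-at y (>-wellFounded y) b≤y x<y y<z t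
      ; wraps  = λ a∼b →
          let β , β∼a , β< = _↝_.wrap (↝-at {zero} {t} z≤n) bottom a∼b in
          β , β∼a , β< ∼-refl
      ; nested = λ a≁b →
          let β , _ , β< = _↝_.wrap (↝-at {t} {fromℕ n} (Fin.≤fromℕ t)) a≁b top in
          β , λ {x} → β< {x}
      }
      where
      bottom : ¬ v zero ⊢ a ∼ b
      bottom a∼b = ℕ.<-irrefl (cong toℕ (discrete⁻
        (≼⇒⊑ {σ = v zero} {discrete} (proj₁ (proj₁ pf) discrete) a∼b))) a<b

      top : v (fromℕ n) ⊢ a ∼ b
      top = ≼⇒⊑ {σ = indiscrete} {v (fromℕ n)} (proj₁ (proj₂ (proj₁ pf)) indiscrete) indiscrete⁺

  onPFChain⇒good : ∀ {π} → OnPFChain n k π → Good π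
  onPFChain⇒good (c , pf , i , refl) = FromChain.good-at c pf i

  pfCover⇒↝ : ∀ {σ τ} → PFCover n k σ τ → σ ↝ τ
  pfCover⇒↝ (c , pf , i , refl , refl) = FromChain.step-↝ c pf i

  star⇒↝ : ∀ {σ τ} → Star (PFCover n k) σ τ → σ ↝ τ
  star⇒↝ = fold _↝_ (↝-trans ∘ pfCover⇒↝) ↝-refl

  module _ {σ τ : Partition} (S : PFStep σ τ) {l : Fin (suc n)}
           (L : IsLabel (PFStep.covers S) l) where
    open PFStep S
    open Cover covers
    open IsLabel L

    -- Were a the label, a would lie in the block of i, and j would be at least b. If b is related
    -- to a in σ, it is j or a larger candidate for the label. If the step relates them, i exceeds
    -- the wrapping β although i is the minimum of their τ-block. If τ does not relate them,
    -- convexity of τ at b, between a and j, is violated.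
    label≢a : l ≢ a
    label≢a l≡a with σ ⊢ a ∼? b | τ ⊢ a ∼? b | ≤⇒<⊎≡ b≤j
      where
      b≤j : b Fin.≤ j
      b≤j = subst (ℕ._≤ toℕ j) (trans (cong suc (cong toℕ l≡a)) a⋖b) l<j
    ... | no σ≁  | yes τ∼ | _         = let β , β∼a , β< = _↝_.wrap step σ≁ τ∼ in
      contradiction (i-min-τ covers (∼-sym (∼-trans β∼a (extend merging (∼-sym i∼a)))))
        (ℕ.<⇒≱ (β< i∼a))
      where
      i∼a : σ ⊢ i ∼ a
      i∼a = subst (σ ⊢ i ∼_) l≡a i∼l
    ... | yes σ∼ | _      | inj₁ b<j  = ℕ.<⇒≱ a<b
      (subst (b Fin.≤_) l≡a (greatest (∼-trans i∼l (subst (σ ⊢_∼ b) (sym l≡a) σ∼)) b<j))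
    ... | yes σ∼ | _      | inj₂ refl = i≁j (∼-trans i∼l (subst (σ ⊢_∼ b) (sym l≡a) σ∼))
    ... | no _   | no τ≁  | b≤j       = τ≁ (a∼b b≤j)
      where
      a∼j : τ ⊢ a ∼ j
      a∼j = subst (τ ⊢_∼ j) l≡a (∼-trans (extend merging (∼-sym i∼l)) (joined merging))
      a∼b : b Fin.< j ⊎ b ≡ j → τ ⊢ a ∼ b
      a∼b (inj₂ refl) = a∼j
      a∼b (inj₁ b<j)  = ∼-trans a∼j (∼-sym (convex good₂ ℕ.≤-refl a<b b<j a∼j))

    -- Every label above k occurs because the step that joins y to its successor z carries the label
    -- y: convexity of σ leaves only the case that y is in the block of i and z is j.
    label≡ : ∀ {y z} → b Fin.≤ y → toℕ z ≡ suc (toℕ y) → ¬ σ ⊢ y ∼ z → τ ⊢ y ∼ z → l ≡ y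
    label≡ {y} {z} b≤y z≡ y≁z y∼z with split merging y∼z
    ... | inj₁ yz = contradiction yz y≁z
    ... | inj₂ (inj₂ (yj , iz)) = contradiction
      (convex good₁ b≤y (ℕ.<-≤-trans i<j (j-min (∼-sym yj))) (ℕ.≤-reflexive (sym z≡)) iz) y≁z
    ... | inj₂ (inj₁ (yi , jz)) with Fin.<-cmp j y
    ...   | tri≈ _ refl _ = contradiction (∼-sym yi) i≁j
    ...   | tri< j<y _ _  = contradiction (convex good₁ b≤y j<y (ℕ.≤-reflexive (sym z≡)) jz) y≁z
    ...   | tri> _ _ y<j  = Fin.≤-antisym
      (ℕ.s≤s⁻¹ (ℕ.≤-trans l<j (ℕ.≤-trans (j-min jz) (ℕ.≤-reflexive z≡)))) (greatest (∼-sym yi) y<j)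

  module FromSteps {h} (c : Vec Partition (suc h))
                   (c₀ : lookup c zero ≡ discrete) (c₁ : lookup c (fromℕ h) ≡ indiscrete)
                   (steps : ∀ i → PFStep (lookup c (inject₁ i)) (lookup c (suc i))) where
    private
      v : Fin (suc h) → Partition
      v = lookup c

      covers : ∀ i → Cover (v (inject₁ i)) (v (suc i))
      covers = PFStep.covers ∘ steps

      joins : Fin h → Fin (suc n)
      joins = Cover.j ∘ covers

      mono : ∀ {i j} → i Fin.≤ j → v i ⊑ v j
      mono = steps-mono {R = _⊑_} (λ xy → xy) (λ s t xy → t (s xy)) v
        (extend ∘ Cover.merging ∘ covers)

      bottom : ∀ {x y} → v zero ⊢ x ∼ y → x ≡ y
      bottom = discrete⁻ ∘ subst (_⊢ _ ∼ _) c₀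

      top : ∀ {x y} → v (fromℕ h) ⊢ x ∼ y
      top = subst (_⊢ _ ∼ _) (sym c₁) indiscrete⁺

      joins-≮ : ∀ {i j} → joins i ≡ joins j → ¬ i Fin.< j
      joins-≮ {i} {j} eq i<j = j-not-min (covers i) λ x∼y →
        subst (λ x → IsMin (v (inject₁ j)) x) (sym eq) (Cover.j-min (covers j))
          (mono (subst (suc (toℕ i) ℕ.≤_) (sym (Fin.toℕ-inject₁ j)) i<j) x∼y)

      joins-injective : Injective _≡_ _≡_ joins
      joins-injective {i} {j} eq with Fin.<-cmp i j
      ... | tri< i<j _ _ = contradiction i<j (joins-≮ eq)
      ... | tri≈ _ i≡j _ = i≡j
      ... | tri> _ _ j<i = contradiction j<i (joins-≮ (sym eq))

      joins-suc : ∀ i → ∃ λ x → joins i ≡ suc x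
      joins-suc i with joins i | Cover.i<j (covers i)
      ... | suc x | _ = x , refl

      joins⁻ : Fin h → Fin n
      joins⁻ = proj₁ ∘ joins-suc

      joins⁻-injective : Injective _≡_ _≡_ joins⁻
      joins⁻-injective {i} {j} eq = joins-injective
        (trans (proj₂ (joins-suc i)) (trans (cong suc eq) (sym (proj₂ (joins-suc j)))))

      ∃joins : ∀ x → ∃ λ i → suc x ≡ joins i
      ∃joins x with ∃-switch (λ t → isMin? (v t) (suc x)) (ℕ.≤-reflexive ∘ cong toℕ ∘ bottom)
                             (λ x-min → contradiction (x-min {zero} top) λ ())
      ... | i , min , ¬min = i , lost-min (covers i) min ¬min

    -- The n elements other than the least are block minima at the bottom and not at the top, and
    -- each cover destroys exactly one of them.
    height : h ≡ n
    height = ℕ.≤-antisym (Fin.injective⇒≤ joins⁻-injective) (Fin.injective⇒≤ {f = proj₁ ∘ ∃joins}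
      λ {x} {y} eq → Fin.suc-injective
        (trans (proj₂ (∃joins x)) (trans (cong joins eq) (sym (proj₂ (∃joins y))))))

    private
      label : Fin h → Fin (suc n)
      label i = proj₁ (∃label (covers i))

      isLabel : ∀ i → IsLabel (covers i) (label i)
      isLabel i = proj₂ (∃label (covers i))

      labels : Vec (Fin (suc n)) h
      labels = tabulate label

      numbers : Vec ℕ h
      numbers = Vec.map number labels

      lookup-numbers : ∀ i → lookup numbers i ≡ number (label i)
      lookup-numbers i = trans (lookup-map i number labels) (cong number (lookup∘tabulate label i))

      k∉numbers : ¬ k ∈ᵥ numbers
      k∉numbers k∈ with ∈⇒∃lookup k∈
      ... | i , k≡ = label≢a (steps i) (isLabel i) (Fin.toℕ-injective (ℕ.suc-injective
        (trans (sym (trans k≡ (lookup-numbers i))) (sym (trans a⋖b b≡k)))))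

      >k∈numbers : ∀ j → k < j → j ≤ n → j ∈ᵥ numbers
      >k∈numbers (suc j) k<j j<n =
        found (∃-switch (λ t → ¬? (v t ⊢ y ∼? z)) (y≢z ∘ bottom) (λ y≁z → y≁z top))
        where
        y z : Fin (suc n)
        y = fromℕ< (ℕ.m≤n⇒m≤1+n j<n)
        z = fromℕ< (s≤s j<n)

        y≡ : toℕ y ≡ j
        y≡ = Fin.toℕ-fromℕ< (ℕ.m≤n⇒m≤1+n j<n)

        z≡ : toℕ z ≡ suc (toℕ y)
        z≡ = trans (Fin.toℕ-fromℕ< (s≤s j<n)) (cong suc (sym y≡))

        y≢z : y ≢ z
        y≢z y≡z = ℕ.1+n≢n (trans (sym z≡) (sym (cong toℕ y≡z)))

        b≤y : b Fin.≤ y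
        b≤y = subst₂ ℕ._≤_ (sym b≡k) (sym y≡) (ℕ.s≤s⁻¹ k<j)

        found : (∃ λ i → ¬ v (inject₁ i) ⊢ y ∼ z × ¬ ¬ v (suc i) ⊢ y ∼ z) → suc j ∈ᵥ numbers
        found (i , y≁z , ¬y≁z) = subst (_∈ᵥ numbers)
          (trans (lookup-numbers i) (trans
            (cong number (label≡ (steps i) (isLabel i) b≤y z≡ y≁z
              (decidable-stable (v (suc i) ⊢ y ∼? z) ¬y≁z)))
            (cong suc y≡)))
          (∈-lookup i numbers)

      isPFChain : (h≡n : h ≡ n) → IsPFChain n k (subst (Vec Partition ∘ suc) h≡n c)
      isPFChain refl =
        ( (λ π → ⊑⇒≼ {σ = v zero} {π} λ x∼y → subst (π ⊢ _ ∼_) (bottom x∼y) ∼-refl)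
        , (λ π → ⊑⇒≼ {σ = π} {v (fromℕ n)} λ _ → top)
        , cover⇒⋖ ∘ covers )
        , labels
        , (λ i → subst (Label (v (inject₁ i)) (v (suc i))) (sym (lookup∘tabulate label i))
            (isLabel⇒label (covers i) (isLabel i)))
        -- Each label is less than the j of its cover, and these j are distinct.
        , dominated⇒isParkingFunction numbers joins⁻ joins⁻-injective
            (λ i → subst (1 ℕ.≤_) (sym (lookup-numbers i)) (s≤s z≤n))
            (λ i → subst₂ ℕ._≤_ (sym (lookup-numbers i)) (cong toℕ (proj₂ (joins-suc i)))
              (IsLabel.l<j (isLabel i)))
        , k∉numbers
        , >k∈numbers

    onPFChain : ∀ i → OnPFChain n k (v i)
    onPFChain = on height
      where
      on : h ≡ n → ∀ i → OnPFChain n k (v i)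
      on refl i = c , isPFChain refl , i , refl

    pfCover : ∀ i → PFCover n k (v (inject₁ i)) (v (suc i))
    pfCover = on height
      where
      on : h ≡ n → ∀ i → PFCover n k (v (inject₁ i)) (v (suc i))
      on refl i = c , isPFChain refl , i , refl , refl

  private
    variable
      π σ τ : Partition

    length : Star PFStep σ τ → ℕ
    length ε       = 0
    length (_ ◅ s) = suc (length s)

    visited : (s : Star PFStep σ τ) → Vec Partition (suc (length s))
    visited {σ} ε       = σ ∷ []
    visited {σ} (_ ◅ s) = σ ∷ visited s

    visited-first : (s : Star PFStep σ τ) → lookup (visited s) zero ≡ σ
    visited-first ε       = refl
    visited-first (_ ◅ _) = refl

    visited-last : (s : Star PFStep σ τ) → lookup (visited s) (fromℕ (length s)) ≡ τ
    visited-last ε       = refl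
    visited-last (_ ◅ s) = visited-last s

    visited-steps : (s : Star PFStep σ τ) (i : Fin (length s)) →
                    PFStep (lookup (visited s) (inject₁ i)) (lookup (visited s) (suc i))
    visited-steps (t ◅ s) zero    = subst (PFStep _) (sym (visited-first s)) t
    visited-steps (_ ◅ s) (suc i) = visited-steps s i

    visits : ∀ {ρ} (s : Star PFStep σ ρ) (t : Star PFStep ρ τ) →
             ∃ λ i → lookup (visited (s ◅◅ t)) i ≡ ρ
    visits ε       t = zero , visited-first t
    visits (_ ◅ s) t = let i , eq = visits s t in suc i , eq

    crosses : ∀ {ρ ρ′} (s : Star PFStep σ ρ) (u : PFStep ρ ρ′) (t : Star PFStep ρ′ τ) →
              ∃ λ i → lookup (visited (s ◅◅ u ◅ t)) (inject₁ i) ≡ ρ ×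
                      lookup (visited (s ◅◅ u ◅ t)) (suc i) ≡ ρ′
    crosses ε       u t = zero , refl , visited-first t
    crosses (_ ◅ s) u t = let i , eq , eq′ = crosses s u t in suc i , eq , eq′

    module Visited (s : Star PFStep discrete indiscrete) =
      FromSteps (visited s) (visited-first s) (visited-last s) (visited-steps s)

  good⇒onPFChain : Good π → OnPFChain n k π
  good⇒onPFChain {π} π-good = let i , eq = visits s t in
    subst (OnPFChain n k) eq (Visited.onPFChain (s ◅◅ t) i)
    where
    s : Star PFStep discrete π
    s = ↝⇒star discrete-good π-good (discrete-↝ π-good)
    t : Star PFStep π indiscrete
    t = ↝⇒star π-good indiscrete-good (↝-indiscrete π-good)

  -- A cover of P must lie on a complete chain; since both ends are good, the step extends down to
  -- the discrete partition and up to the indiscrete one.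
  pfStep⇒pfCover : PFStep σ τ → PFCover n k σ τ
  pfStep⇒pfCover {σ} {τ} u = let i , eq , eq′ = crosses s u t in
    subst₂ (PFCover n k) eq eq′ (Visited.pfCover (s ◅◅ u ◅ t) i)
    where
    open PFStep u
    s : Star PFStep discrete σ
    s = ↝⇒star discrete-good good₁ (discrete-↝ good₁)
    t : Star PFStep τ indiscrete
    t = ↝⇒star good₂ indiscrete-good (↝-indiscrete good₂)

  -- Together with `star⇒↝` this identifies the order of P with `_↝_` on good partitions and frees
  -- the Möbius argument from labels.
  ↝⇒≤ : Good σ → Good τ → σ ↝ τ → Star (PFCover n k) σ τ
  ↝⇒≤ σ-good τ-good = gmap id pfStep⇒pfCover ∘ ↝⇒star σ-good τ-good

-- Vanishing of the Möbius function

module PFMöbius {n k : ℕ} (a b : Fin (suc n)) (a⋖b : suc (toℕ a) ≡ toℕ b) (0<a : 0 < toℕ a)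
                (b≡k : toℕ b ≡ k) where
  open PFOrder a b a⋖b 0<a
  open PFChains a b a⋖b 0<a b≡k
  open FinitePoset (PosetPF n k) using (Carrier; _≤?_; _<?_; <-wellFounded; ≤-trans)
    renaming (_≤_ to _≤ᴾ_; _<_ to _<ᴾ_)
  open Möbius (PosetPF n k) using (μ; ∑)

  good : (x : Carrier) → Good (value x)
  good (π , [ p ]) = onPFChain⇒good (recompute (onPFChain? n k π) p)

  element : ∀ {π} → Good π → Carrier
  element {π} π-good = π , [ good⇒onPFChain π-good ]

  0̂ 1̂ : Carrier
  0̂ = element discrete-good
  1̂ = element indiscrete-good

  0̂-minimum : Minimum _≤ᴾ_ 0̂
  0̂-minimum x = ↝⇒≤ discrete-good (good x) (discrete-↝ (good x))

  1̂-maximum : Maximum _≤ᴾ_ 1̂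
  1̂-maximum x = ↝⇒≤ (good x) indiscrete-good (↝-indiscrete (good x))

  module _ (x : Carrier) (x∼ : value x ⊢ a ∼ b) where
    private
      β : Fin (suc n)
      β = proj₁ (blockMin (value x) a)

      a∼β : value x ⊢ a ∼ β
      a∼β = proj₁ (proj₂ (blockMin (value x) a))

      β-least : IsMin (value x) β
      β-least = proj₂ (proj₂ (blockMin (value x) a))

    Unjoined : Carrier → Set
    Unjoined y = y ≤ᴾ x × ¬ value y ⊢ a ∼ b

    unjoined? : ∀ y → Dec (Unjoined y)
    unjoined? y = (y ≤? x) ×-dec ¬? (value y ⊢ a ∼? b)

    private
      unjoined-↓ : ∀ {y z} → y ≤ᴾ z → Unjoined z → Unjoined y
      unjoined-↓ {y} {z} y≤z (z≤x , z≁) = ≤-trans {y} {z} {x} y≤z z≤x , z≁ ∘ _↝_.incl (star⇒↝ y≤z)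

      Closed : Carrier → Set
      Closed y = value y ⊢ β ∼ b

      0̂-not-closed : ¬ Closed 0̂
      0̂-not-closed β∼b = ℕ.<⇒≱ a<b (ℕ.≤-trans
        (ℕ.≤-reflexive (sym (cong toℕ (discrete⁻ β∼b)))) (β-least (∼-sym a∼β)))

      closure : ∀ {y} → Unjoined y → ∃ λ z → (Unjoined z × Closed z) × y ≤ᴾ z ×
                (∀ {w} → Unjoined w → Closed w → y ≤ᴾ w → z ≤ᴾ w)
      closure {y} (y≤x , y≁) = element ρ-good ,
        ((↝⇒≤ ρ-good (good x) (⇝⇒↝ ρ⇝τ) , ρ≁) , subst (ρ ⊢_∼ b) β≡ (joined merging)) ,
        ↝⇒≤ (good y) ρ-good (⇝⇒↝ σ⇝ρ) ,
        -- As w is unjoined, `wrap` is vacuous and leastness of the merge suffices.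
        λ {w} (_ , w≁) β∼b y≤w → ↝⇒≤ ρ-good (good w) (record
          { incl = merge-least merging (_↝_.incl (star⇒↝ y≤w)) (subst (value w ⊢_∼ b) (sym β≡) β∼b)
          ; wrap = λ _ w∼ → contradiction w∼ w≁ })
        where
        open Wrapping (wrapping (good y) (star⇒↝ y≤x) y≁ x∼) renaming (β to β′)
        β≡ : β′ ≡ β
        β≡ = min-unique β-min β-least (∼-trans β∼a a∼β)

    ∑-unjoined : ∑ (λ y → when (unjoined? y) (μ 0̂ y)) ≡ 0ℤ
    ∑-unjoined = ∑-closure (PosetPF n k) 0̂-minimum {C = Closed} unjoined?
      (λ {y} {z} → unjoined-↓ {y} {z}) 0̂-not-closed (λ {y} → closure {y})

  μ-joined : ∀ x → Acc _<ᴾ_ x → value x ⊢ a ∼ b → μ 0̂ x ≡ 0ℤ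
  μ-joined x (acc rec) x∼ = trans (μ-below (PosetPF n k) 0̂-minimum λ { refl → 0̂≁ x∼ })
    (cong ℤ.-_ (trans (∑-cong (PosetPF n k) terms) (∑-unjoined x x∼)))
    where
    0̂≁ : ¬ discrete ⊢ a ∼ b
    0̂≁ a∼b = ℕ.<-irrefl (cong toℕ (discrete⁻ a∼b)) a<b

    terms : ∀ y → when (y <? x) (μ 0̂ y) ≡ when (unjoined? x x∼ y) (μ 0̂ y)
    terms y = case (value y ⊢ a ∼? b)
      where
      case : Dec (value y ⊢ a ∼ b) →
             when (y <? x) (μ 0̂ y) ≡ when (unjoined? x x∼ y) (μ 0̂ y)
      case (no y≁) = when-⇔ (y <? x) (unjoined? x x∼ y) (λ y<x → proj₁ y<x , y≁)
        (λ (y≤x , _) → y≤x , λ { refl → y≁ x∼ })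
      case (yes y∼) = trans (zero-or (y <? x)) (sym (when-no (unjoined? x x∼ y) λ p → proj₂ p y∼))
        where
        zero-or : (d : Dec (y <ᴾ x)) → when d (μ 0̂ y) ≡ 0ℤ
        zero-or (yes y<x) = μ-joined y (rec y<x) y∼
        zero-or (no _)    = refl

theorem3 : ∀ (n k : ℕ) → 1 < k → k ≤ n →
    let open FinitePoset (PosetPF n k) renaming (_≤_ to _≤ᴾ_)
        open Möbius (PosetPF n k) using (μ)
    in ∃₂ λ 0̂ 1̂ → Minimum _≤ᴾ_ 0̂ × Maximum _≤ᴾ_ 1̂ × μ 0̂ 1̂ ≡ 0ℤ
theorem3 n (suc k) (s≤s 0<k) k<n =
  0̂ , 1̂ , 0̂-minimum , 1̂-maximum , μ-joined 1̂ (<-wellFounded 1̂) indiscrete⁺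
  where
  -- Indices start at 0 and the pattern has lowered k by one: a, at index k, stands for the number
  -- `suc k` of the statement, and b for the next number.
  a b : Fin (suc n)
  a = fromℕ< (ℕ.m≤n⇒m≤1+n k<n)
  b = fromℕ< (s≤s k<n)

  a≡k : toℕ a ≡ k
  a≡k = Fin.toℕ-fromℕ< (ℕ.m≤n⇒m≤1+n k<n)

  b≡1+k : toℕ b ≡ suc k
  b≡1+k = Fin.toℕ-fromℕ< (s≤s k<n)

  open PFOrder a b (trans (cong suc a≡k) (sym b≡1+k)) (subst (0 <_) (sym a≡k) 0<k)
  open PFMöbius a b (trans (cong suc a≡k) (sym b≡1+k)) (subst (0 <_) (sym a≡k) 0<k) b≡1+k
  open FinitePoset (PosetPF n (suc k)) using (<-wellFounded)
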